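{- Let $G$ be a connected planar graph on at least $3$ vertices. Then $\kappa(G)-1\leq \kappa_3(G)\leq \kappa(G)$.
   Context: All graphs are finite and simple. $\kappa(G)$ denotes the (vertex) connectivity of $G$: the minimum cardinality of a vertex set $Q$ such that $G-Q$ is disconnected or trivial. For a set $S$ of vertices of a connected graph $G$, a tree connecting $S$ is a subtree of $G$ containing all vertices of $S$; $\kappa(S)$ denotes the maximum number $\ell$ of edge-disjoint trees $T_1,\ldots,T_\ell$ in $G$, each connecting $S$, such that $V(T_i)\cap V(T_j)=S$ for all distinct $i,j$. The $3$-connectivity is $\kappa_3(G)=\min\{\kappa(S): S\subseteq V(G),\ |S|=3\}$. -}

module Defs where

open import Data.Nat using (ℕ; zero; suc; _+_; _*_; _≤_; _≤ᵇ_; _∸_)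
open import Data.Bool using (Bool; true; false; if_then_else_; _∧_; _∨_; not)
open import Data.Fin using (Fin; toℕ; zero; suc; inject₁; fromℕ; _≟_)
open import Data.Fin.Subset using (Subset; _∈_; _⊆_; ⊤; ∁; ∣_∣)
open import Data.List using (List; map; allFin; upTo)
open import Data.Nat.ListAction using (sum)
open import Data.Bool.ListAction using (all; any)
open import Data.Product using (Σ; ∃; _×_; _,_)
open import Data.Sum using (_⊎_)
open import Relation.Binary.PropositionalEquality using (_≡_)
open import Relation.Nullary using (¬_; does)
open import Function.Definitions using (Injective)

record Graph (n : ℕ) : Set where
  field
    adj   : Fin n → Fin n → Bool
    sym   : ∀ u v → adj u v ≡ adj v u
    irrefl : ∀ u → adj u u ≡ false
open Graph public

data Walk {n : ℕ} (X : Subset n) (E : Fin n → Fin n → Bool) : Fin n → Fin n → Set where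
  here : ∀ {u} → u ∈ X → Walk X E u u
  step : ∀ {u w v} → u ∈ X → E u w ≡ true → Walk X E w v → Walk X E u v

Connected : ∀ {n} → Graph n → Set
Connected {n} G = ∀ (u v : Fin n) → Walk ⊤ (adj G) u v

DisconnectsOrTrivial : ∀ {n} → Graph n → Subset n → Set
DisconnectsOrTrivial {n} G Q =
  (∣ ∁ Q ∣ ≤ 1) ⊎
  Σ (Fin n) λ u → Σ (Fin n) λ v → u ∈ ∁ Q × v ∈ ∁ Q × ¬ Walk (∁ Q) (adj G) u v

IsConnectivity : ∀ {n} → Graph n → ℕ → Set
IsConnectivity {n} G k =
  (Σ (Subset n) λ Q → ∣ Q ∣ ≡ k × DisconnectsOrTrivial G Q) ×
  (∀ (Q : Subset n) → DisconnectsOrTrivial G Q → k ≤ ∣ Q ∣)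

iter : ∀ {A : Set} → (A → A) → ℕ → A → A
iter f zero x = x
iter f (suc k) x = f (iter f k x)

Cycle : ∀ {n} → (Fin n → Fin n → Bool) → Set
Cycle {n} E =
  Σ ℕ λ m → Σ (Fin (suc (suc (suc m))) → Fin n) λ c →
    Injective _≡_ _≡_ c ×
    (∀ (i : Fin (suc (suc m))) → E (c (inject₁ i)) (c (suc i)) ≡ true) ×
    E (c (fromℕ (suc (suc m)))) (c zero) ≡ true

record Subtree {n : ℕ} (G : Graph n) : Set where
  field
    verts    : Subset n
    edges    : Fin n → Fin n → Bool
    edges-sym : ∀ u v → edges u v ≡ edges v u
    edges-in-G : ∀ u v → edges u v ≡ true → adj G u v ≡ true
    edges-in-verts : ∀ u v → edges u v ≡ true → u ∈ verts × v ∈ verts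
    connected : ∀ u v → u ∈ verts → v ∈ verts → Walk verts edges u v
    acyclic  : ¬ Cycle edges
open Subtree public

record TreePacking {n : ℕ} (G : Graph n) (S : Subset n) (ℓ : ℕ) : Set where
  field
    tree     : Fin ℓ → Subtree G
    connects : ∀ i → S ⊆ verts (tree i)
    edge-disjoint : ∀ i j → ¬ (i ≡ j) → ∀ u v →
      edges (tree i) u v ≡ true → edges (tree j) u v ≡ false
    vert-meet : ∀ i j → ¬ (i ≡ j) → ∀ v →
      v ∈ verts (tree i) → v ∈ verts (tree j) → v ∈ S

IsKappaS : ∀ {n} → Graph n → Subset n → ℕ → Set
IsKappaS G S ℓ = TreePacking G S ℓ × (∀ m → TreePacking G S m → m ≤ ℓ)

IsKappa3 : ∀ {n} → Graph n → ℕ → Set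
IsKappa3 {n} G k =
  (Σ (Subset n) λ S → ∣ S ∣ ≡ 3 × IsKappaS G S k) ×
  (∀ (S : Subset n) (ℓ : ℕ) → ∣ S ∣ ≡ 3 → IsKappaS G S ℓ → k ≤ ℓ)

countB : ∀ {n} → (Fin n → Bool) → ℕ
countB {n} f = sum (map (λ i → if f i then 1 else 0) (allFin n))

record Rotation {n : ℕ} (G : Graph n) : Set where
  field
    ρ      : Fin n → Fin n → Fin n
    closed : ∀ u v → adj G u v ≡ true → adj G u (ρ u v) ≡ true
    inj    : ∀ u v w → adj G u v ≡ true → adj G u w ≡ true → ρ u v ≡ ρ u w → v ≡ w
    cyclic : ∀ u v w → adj G u v ≡ true → adj G u w ≡ true →
             Σ ℕ λ k → iter (ρ u) k v ≡ w
open Rotation public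

module _ {n : ℕ} (G : Graph n) (R : Rotation G) where
  -- face permutation on darts (u , v)
  φ : Fin n × Fin n → Fin n × Fin n
  φ (u , v) = (v , ρ R v u)

  key : Fin n × Fin n → ℕ
  key (u , v) = toℕ u * n + toℕ v

  -- dart d is the least (by key) dart in its φ-orbit (orbits have length ≤ n*n)
  orbitMin : Fin n × Fin n → Bool
  orbitMin d = all (λ k → key d ≤ᵇ key (iter φ k d)) (upTo (n * n))

  faces : ℕ
  faces = sum (map (λ u → countB (λ v → adj G u v ∧ orbitMin (u , v))) (allFin n))

edgeCount : ∀ {n} → Graph n → ℕ
edgeCount {n} G = sum (map (λ u → countB (λ v → adj G u v ∧ (toℕ u <ᵇ' toℕ v))) (allFin n))
  where
  _<ᵇ'_ : ℕ → ℕ → Bool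
  a <ᵇ' b = suc a ≤ᵇ b

reach : ∀ {n} → Graph n → ℕ → Fin n → Fin n → Bool
reach G zero u v = does (u ≟ v)
reach {n} G (suc k) u v = reach G k u v ∨ any (λ w → reach G k u w ∧ adj G w v) (allFin n)

-- number of connected components (vertices least in their component)
components : ∀ {n} → Graph n → ℕ
components {n} G = countB (λ v → all (λ w → not (reach G n w v) ∨ (toℕ v ≤ᵇ toℕ w)) (allFin n))

-- number of isolated vertices (each bounds one face not counted by dart orbits)
isolated : ∀ {n} → Graph n → ℕ
isolated {n} G = countB (λ v → not (any (adj G v) (allFin n)))

-- G is planar: some rotation system has Euler genus 0 on every component,
-- i.e.  V - E + F = 2·(#components)
Planar : ∀ {n} → Graph n → Set
Planar {n} G = Σ (Rotation G) λ R →
  n + faces G R + isolated G ≡ edgeCount G + 2 * components G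

{-# OPTIONS --safe #-}
-- Upper bound: let Q be a minimum cut separating u and v. Either some w ∉ Q is distinct from u, v,
-- and each tree of a packing for {u , v , w} contains its own vertex of Q; or Q contains all other
-- vertices, and the trees use distinct edges from u to Q.
--
-- Lower bound: κ is at most the minimum degree, which Euler's formula bounds by 5. For terminals
-- S = {a , b , c}, call an element a non-terminal vertex or an edge inside S; each terminal is
-- separated from the other two only by at least κ elements. By uncrossing separators
-- (Hind–Oellermann) an edge between non-terminals can always be deleted or contracted without
-- destroying this property, until the non-terminals form independent connected blocks. If t blocks
-- meet all of S, and x, y, z meet exactly {b , c}, {a , c}, {a , b}, then t + y + z, t + x + z and
-- t + x + y are at least κ. A block of the first sort gives a tree, and so do two blocks of different
-- other sorts; for κ ≤ 5 this yields κ - 1 disjoint trees.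
--
-- Both inequalities are decidable, so all existence arguments may be carried out under ¬¬.
module Submission where

open import Defs renaming (sym to adj-sym)
open import Data.Nat using (ℕ; zero; suc; _+_; _*_; _∸_; _≤_; _<_; _≤ᵇ_; z≤n; s≤s; _≤?_)
open import Data.Nat.Properties hiding (_≟_; _≤?_; suc-injective)
open import Data.Nat.ListAction using () renaming (sum to listSum)
open import Data.Nat.ListAction.Properties using (sum-++)
open import Data.Nat.Solver using (module +-*-Solver)
open import Data.Bool as Bool using (Bool; true; false; if_then_else_; _∧_; _∨_; not; T?)
open import Data.Bool.Properties using (T-≡; ∧-zeroʳ; ∧-identityʳ; ∨-zeroʳ)
open import Data.Bool.ListAction using (any; all)
open import Data.Fin using (Fin; zero; suc; _≟_; toℕ; inject₁; fromℕ; combine; remQuot)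
open import Data.Fin.Patterns using (0F; 1F; 2F)
open import Data.Fin.Properties using (any?; all?; injective⇒≤; suc-injective; toℕ-injective; toℕ<n; fromℕ≢inject₁; pigeonhole; combine-injective; combine-remQuot; toℕ-combine)
open import Data.Fin.Induction using (<-weakInduction)
open import Data.Fin.Permutation using (Permutation; _⟨$⟩ʳ_; transpose)
open import Data.Fin.Subset using (Subset; _∈_; _∉_; _⊆_; ∁; ∣_∣; ⁅_⁆)
open import Data.Fin.Subset.Properties using (_∈?_; x∈∁p⇒x∉p; x∉p⇒x∈∁p; p⊆q⇒∣p∣≤∣q∣; x∈⁅x⁆; ∣⁅x⁆∣≡1; ∣∁p∣≡n∸∣p∣)
import Data.Vec as Vec
open import Data.Vec.Properties using ([]=⇒lookup; lookup⇒[]=; lookup∘tabulate)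
open import Data.Maybe using (Maybe; just; nothing)
open import Data.Maybe.Properties using (≡-dec)
open import Data.List using (List; []; _∷_; _++_; map; allFin; tabulate; length; lookup; filter; filterᵇ; cartesianProduct; replicate)
open import Data.List.Properties using (map-∘; map-++; map-tabulate; length-tabulate; length-++; length-map; length-replicate)
open import Data.List.Membership.Propositional using () renaming (_∈_ to _∈ˡ_)
open import Data.List.Membership.Propositional.Properties using (∈-filter⁺; ∈-filter⁻; ∈-allFin; ∈-tabulate⁻; ∈-lookup; ∈-cartesianProduct⁺; ∈-upTo⁺)
open import Data.List.Relation.Unary.Any using (here; there; index)
open import Data.List.Relation.Unary.Any.Properties using (lookup-index)
open import Data.List.Relation.Unary.All as All using (All; []; _∷_)
open import Data.List.Relation.Unary.All.Properties using (all-filter)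
open import Data.List.Relation.Unary.AllPairs using ([]; _∷_)
open import Data.List.Relation.Unary.Unique.Propositional using (Unique)
open import Data.List.Relation.Unary.Unique.Propositional.Properties using (tabulate⁺; filter⁺; cartesianProduct⁺; allFin⁺)
open import Data.Product using (Σ; ∃; ∃₂; _×_; _,_; proj₁; proj₂)
open import Data.Sum using (_⊎_; inj₁; inj₂; [_,_])
open import Data.Empty using (⊥)
open import Data.Unit using (tt)
open import Function using (_∘_; id; case_of_; Equivalence)
open import Function.Definitions using (Injective)
open import Relation.Nullary using (¬_; Dec; yes; no; does; contradiction; ¬?)
open import Relation.Nullary.Decidable using (dec-true; dec-false; decidable-stable; toWitness; _×-dec_; _⊎-dec_; _→-dec_)
open import Relation.Unary using (Decidable)
open import Relation.Binary.PropositionalEquality using (_≡_; _≢_; refl; sym; trans; cong; cong₂; subst)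
open import Relation.Binary.Definitions using (tri<; tri≈; tri>)
open import Relation.Binary.Construct.Closure.ReflexiveTransitive as Star using (Star; ε; _◅_; _◅◅_)
open import Algebra.Properties.CommutativeMonoid.Sum +-0-commutativeMonoid using (∑-distrib-+; ∑-comm; ∑-permute; sum-cong-≗) renaming (sum to ∑)

-- Why elements: a vertex separator may contain terminals, and the trees may also use edges inside
-- `S`, so vertex cuts alone do not control the packing. A cut here never removes a terminal but may
-- remove an edge inside `S`; it is turned into a vertex separator of no larger size by exchanging
-- such an edge for one of its ends.
--
-- Why 5, and why one tree is lost: if `t = 0`, every tree costs two blocks, while the three
-- pairwise conditions add up to `2 (x + y + z) ≥ 3 k`. About `3 k / 4` pairs are thus guaranteed.
-- This reaches `k - 1` for `k ≤ 5` and fails at 6: with `x = y = z = 3` the nine blocks form only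
-- four pairs.
--
-- Why blocks suffice: the proof never builds a tree by hand. It selects connected sets of blocks,
-- forms the connected subgraph they span together with `S`, and thins it out to a spanning tree.

∧-true : ∀ {b c} → b ∧ c ≡ true → b ≡ true × c ≡ true
∧-true {true} {true} refl = refl , refl

-- Sums and counting over finite sets

ind : Bool → ℕ
ind b = if b then 1 else 0

#_ : ∀ {n} → (Fin n → Bool) → ℕ
# P = ∑ (ind ∘ P)

∑-mono-≤ : ∀ {n} {f g : Fin n → ℕ} → (∀ i → f i ≤ g i) → ∑ f ≤ ∑ g
∑-mono-≤ {zero}  f≤g = z≤n
∑-mono-≤ {suc n} f≤g = +-mono-≤ (f≤g zero) (∑-mono-≤ (f≤g ∘ suc))

∑-const : ∀ n c → ∑ {n} (λ _ → c) ≡ n * c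
∑-const zero    c = refl
∑-const (suc n) c = cong (c +_) (∑-const n c)

ind-mono-≤ : ∀ b c → (b ≡ true → c ≡ true) → ind b ≤ ind c
ind-mono-≤ false c     b⇒c = z≤n
ind-mono-≤ true  true  b⇒c = s≤s z≤n
ind-mono-≤ true  false b⇒c with () ← b⇒c refl

#-mono-≤ : ∀ {n} (P Q : Fin n → Bool) → (∀ i → P i ≡ true → Q i ≡ true) → # P ≤ # Q
#-mono-≤ P Q P⇒Q = ∑-mono-≤ (λ i → ind-mono-≤ (P i) (Q i) (P⇒Q i))

∑-at-≤ : ∀ {n} (x : Fin n) c → ∑ (λ i → if does (i ≟ x) then c else 0) ≤ c
∑-at-≤ {suc n} zero    c = ≤-reflexive (trans (cong (c +_) (trans (∑-const n 0) (*-zeroʳ n))) (+-identityʳ c))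
∑-at-≤ {suc n} (suc x) c = ∑-at-≤ x c

#-witness : ∀ {n} (P : Fin n → Bool) → 1 ≤ # P → ∃ λ i → P i ≡ true
#-witness {suc n} P 1≤ with P zero in eq
... | true  = zero , eq
... | false = let i , Pi = #-witness (P ∘ suc) 1≤ in suc i , Pi

∣∣≡# : ∀ {n} (Q : Subset n) → ∣ Q ∣ ≡ # (Vec.lookup Q)
∣∣≡# Vec.[]            = refl
∣∣≡# (true  Vec.∷ Q) = cong suc (∣∣≡# Q)
∣∣≡# (false Vec.∷ Q) = ∣∣≡# Q

listSum-tabulate : ∀ {n} (f : Fin n → ℕ) → listSum (tabulate f) ≡ ∑ f
listSum-tabulate {zero}  f = refl
listSum-tabulate {suc n} f = cong (f zero +_) (listSum-tabulate (f ∘ suc))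

listSum-allFin : ∀ {n} (f : Fin n → ℕ) → listSum (map f (allFin n)) ≡ ∑ f
listSum-allFin f = trans (cong listSum (map-tabulate (λ i → i) f)) (listSum-tabulate f)

length-filterᵇ : ∀ {A : Set} (P : A → Bool) xs → length (filterᵇ P xs) ≡ listSum (map (ind ∘ P) xs)
length-filterᵇ P []       = refl
length-filterᵇ P (x ∷ xs) with P x
... | true  = cong suc (length-filterᵇ P xs)
... | false = length-filterᵇ P xs

∈-filterᵇ⁺ : ∀ {A : Set} (P : A → Bool) {x xs} → x ∈ˡ xs → P x ≡ true → x ∈ˡ filterᵇ P xs
∈-filterᵇ⁺ P x∈xs Px = ∈-filter⁺ (T? ∘ P) x∈xs (Equivalence.from T-≡ Px)

Unique-lookup-injective : ∀ {A : Set} {xs : List A} → Unique xs → ∀ i j → lookup xs i ≡ lookup xs j → i ≡ j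
Unique-lookup-injective (x∉ ∷ u) zero    zero    eq = refl
Unique-lookup-injective (x∉ ∷ u) zero    (suc j) eq = contradiction eq (All.lookup x∉ (∈-lookup j))
Unique-lookup-injective (x∉ ∷ u) (suc i) zero    eq = contradiction (sym eq) (All.lookup x∉ (∈-lookup i))
Unique-lookup-injective (x∉ ∷ u) (suc i) (suc j) eq = cong suc (Unique-lookup-injective u i j eq)

Unique-⊆⇒length≤ : ∀ {A : Set} {xs ys : List A} → Unique xs → (∀ {x} → x ∈ˡ xs → x ∈ˡ ys) → length xs ≤ length ys
Unique-⊆⇒length≤ {xs = xs} {ys} u xs⊆ys = injective⇒≤ {f = f} λ {i} {j} eq →
  Unique-lookup-injective u i j (trans (found i) (trans (cong (lookup ys) eq) (sym (found j))))
  where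
  f : Fin (length xs) → Fin (length ys)
  f i = index (xs⊆ys (∈-lookup i))
  found : ∀ i → lookup xs i ≡ lookup ys (f i)
  found i = lookup-index (xs⊆ys (∈-lookup i))

injective⇒≤# : ∀ {m n} (P : Fin n → Bool) (g : Fin m → Fin n) → Injective _≡_ _≡_ g → (∀ i → P (g i) ≡ true) → m ≤ # P
injective⇒≤# {m} {n} P g inj Pg = begin
  m                             ≡⟨ length-tabulate g ⟨
  length (tabulate g)           ≤⟨ Unique-⊆⇒length≤ (tabulate⁺ inj) included ⟩
  length (filterᵇ P (allFin n)) ≡⟨ length-filterᵇ P (allFin n) ⟩
  listSum (map (ind ∘ P) (allFin n)) ≡⟨ listSum-allFin (ind ∘ P) ⟩
  # P ∎
  where
  open ≤-Reasoning
  included : ∀ {x} → x ∈ˡ tabulate g → x ∈ˡ filterᵇ P (allFin n)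
  included x∈ with i , refl ← ∈-tabulate⁻ x∈ = ∈-filterᵇ⁺ P (∈-allFin (g i)) (Pg i)

-- Cuts and their uncrossing

data Side : Set where
  near sep far : Side

flip : Side → Side
flip near = far
flip sep  = sep
flip far  = near

-- The minimum for the order far < sep < near: near sides are intersected, far sides united.
-- Conjugation by `flip` gives the maximum.
meet : Side → Side → Side
meet near b   = b
meet sep  far = far
meet sep  _   = sep
meet far  _   = far

size : Side → ℕ
size sep = 1
size _   = 0

flip-near : ∀ {a} → flip a ≡ near → a ≡ far
flip-near {far} refl = refl

flip-far : ∀ {a} → flip a ≡ far → a ≡ near
flip-far {near} refl = refl

size-flip : ∀ a → size (flip a) ≡ size a
size-flip near = refl
size-flip sep  = refl
size-flip far  = refl

meet-near : ∀ {a b} → meet a b ≡ near → a ≡ near × b ≡ near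
meet-near {near} refl = refl , refl
meet-near {sep} {near} ()
meet-near {sep} {sep} ()
meet-near {sep} {far} ()

meet-far : ∀ {a b} → meet a b ≡ far → a ≡ far ⊎ b ≡ far
meet-far {near} eq         = inj₂ eq
meet-far {far}  eq         = inj₁ refl
meet-far {sep}  {far} eq   = inj₂ refl

-- Submodularity, block by block: minimum and maximum of `a` and `b` are `a` and `b` in some order,
-- and `flip` keeps the size.
size-uncross : ∀ a b → size (meet a b) + size (meet (flip a) (flip b)) ≤ size a + size b
size-uncross near near = z≤n
size-uncross near sep  = s≤s z≤n
size-uncross near far  = z≤n
size-uncross sep  near = s≤s z≤n
size-uncross sep  sep  = s≤s (s≤s z≤n)
size-uncross sep  far  = s≤s z≤n
size-uncross far  near = z≤n
size-uncross far  sep  = s≤s z≤n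
size-uncross far  far  = z≤n

Compatible : Side → Side → Set
Compatible a b = ¬ (a ≡ near × b ≡ far) × ¬ (a ≡ far × b ≡ near)

Split : Side → Side → Set
Split a b = a ≡ near × b ≡ far ⊎ a ≡ far × b ≡ near

compatible? : ∀ a b → Compatible a b ⊎ Split a b
compatible? near near = inj₁ ((λ ()) , λ ())
compatible? near sep  = inj₁ ((λ ()) , λ ())
compatible? near far  = inj₂ (inj₁ (refl , refl))
compatible? sep  b    = inj₁ ((λ ()) , λ ())
compatible? far  near = inj₂ (inj₂ (refl , refl))
compatible? far  sep  = inj₁ ((λ ()) , λ ())
compatible? far  far  = inj₁ ((λ ()) , λ ())

compatible-flip : ∀ {a b} → Compatible a b → Compatible (flip a) (flip b)
compatible-flip (¬nf , ¬fn) =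
  (λ (p , q) → ¬fn (flip-near p , flip-far q)) , (λ (p , q) → ¬nf (flip-far p , flip-near q))

compatible-meet : ∀ {a b a′ b′} → Compatible a b → Compatible a′ b′ → Compatible (meet a a′) (meet b b′)
compatible-meet (¬nf , ¬fn) (¬nf′ , ¬fn′) =
  (λ (p , q) → let p₁ , p₂ = meet-near p in [ (λ r → ¬nf (p₁ , r)) , (λ r → ¬nf′ (p₂ , r)) ] (meet-far q)) ,
  (λ (p , q) → let q₁ , q₂ = meet-near q in [ (λ r → ¬fn (r , q₁)) , (λ r → ¬fn′ (r , q₂)) ] (meet-far p))

compatible-sepˡ : ∀ {a} b → a ≡ sep → Compatible a b
compatible-sepˡ b refl = (λ ()) , λ ()

compatible-sepʳ : ∀ a {b} → b ≡ sep → Compatible a b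
compatible-sepʳ a refl = (λ ()) , λ ()

weight : ∀ {n} → (Fin n → Side) → ℕ
weight f = ∑ (size ∘ f)

-- Contraction of block `q` into block `p`. Labels still range over `Fin n`; for distinct `p` and
-- `q` the label `q` becomes empty, and an empty label adds to the weight of a cut only if the
-- colouring puts it into `sep`.
merge : ∀ {n} → Fin n → Fin n → Fin n → Fin n
merge p q i = if does (i ≟ q) then p else i

merge-≡ : ∀ {n} (p q : Fin n) → merge p q q ≡ p
merge-≡ p q rewrite dec-true (q ≟ q) refl = refl

merge-fix : ∀ {n} (p q : Fin n) → merge p q p ≡ p
merge-fix p q with p ≟ q
... | yes _ = refl
... | no  _ = refl

merge-injective : ∀ {n} (p q i j : Fin n) → merge p q i ≡ merge p q j → i ≡ j ⊎ (i ≡ p × j ≡ q ⊎ i ≡ q × j ≡ p)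
merge-injective p q i j eq with i ≟ q | j ≟ q
... | yes refl | yes refl = inj₁ refl
... | yes refl | no  _    = inj₂ (inj₂ (refl , sym eq))
... | no  _    | yes refl = inj₂ (inj₁ (eq , refl))
... | no  _    | no  _    = inj₁ eq

BlockPath : ∀ {n} → (Fin n → Fin n → Set) → (Fin n → Fin n) → Fin n → Fin n → Set
BlockPath R lab = Star (λ x y → lab x ≡ lab y × R x y)

ConnectedBlocks : ∀ {n} → (Fin n → Fin n → Set) → (Fin n → Fin n) → Set
ConnectedBlocks R lab = ∀ x y → lab x ≡ lab y → BlockPath R lab x y

merge-connected : ∀ {n} {R : Fin n → Fin n → Set} {lab x y} → (∀ {x y} → R x y → R y x) → R x y →
  ConnectedBlocks R lab → ConnectedBlocks R (merge (lab x) (lab y) ∘ lab)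
merge-connected {R = R} {lab} {x} {y} R-sym Rxy conn u v eq = link (merge-injective p q (lab u) (lab v) eq)
  where
  p = lab x
  q = lab y
  joined : merge p q p ≡ merge p q q
  joined = trans (merge-fix p q) (sym (merge-≡ p q))
  coarsen : ∀ {u v} → BlockPath R lab u v → BlockPath R (merge p q ∘ lab) u v
  coarsen = Star.map (λ (e , r) → cong (merge p q) e , r)
  link : lab u ≡ lab v ⊎ (lab u ≡ p × lab v ≡ q ⊎ lab u ≡ q × lab v ≡ p) → BlockPath R (merge p q ∘ lab) u v
  link (inj₁ same)               = coarsen (conn u v same)
  link (inj₂ (inj₁ (u~x , v~y))) = coarsen (conn u x u~x) ◅◅ (joined , Rxy) ◅ coarsen (conn y v (sym v~y))
  link (inj₂ (inj₂ (u~y , v~x))) = coarsen (conn u y u~y) ◅◅ (sym joined , R-sym Rxy) ◅ coarsen (conn x v (sym v~x))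

-- Terminals enter only through the incidence `T e s` between elements and terminals. They receive
-- no colour, so no cut can remove them, and elements that stand for edges are treated like
-- vertices.
module Reduction {n : ℕ} {I : Set} (_≟ᴵ_ : (s t : I) → Dec (s ≡ t)) (T : Fin n → I → Set) (k : ℕ) where

  -- f colours the blocks of the partition given by lab; the blocks coloured sep separate the
  -- terminal s, which lies on the near side, from all other terminals, which lie on the far side.
  record Cut (lab : Fin n → Fin n) (L : List (Fin n × Fin n)) (s : I) (f : Fin n → Side) : Set where
    constructor cut
    field
      edges-ok  : All (λ (x , y) → Compatible (f (lab x)) (f (lab y))) L
      at-s      : ∀ e → T e s → f (lab e) ≢ far
      at-others : ∀ e t → t ≢ s → T e t → f (lab e) ≢ near
  open Cut

  Robust : (Fin n → Fin n) → List (Fin n × Fin n) → Set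
  Robust lab L = ∀ s f → Cut lab L s f → k ≤ weight f

  -- Cuts around one terminal are closed under intersection and union of their near sides; the
  -- second colouring is the union, written through `flip`.
  cross-same : ∀ {lab L s f g} → Cut lab L s f → Cut lab L s g →
    Cut lab L s (λ i → meet (f i) (g i)) × Cut lab L s (λ i → flip (meet (flip (f i)) (flip (g i))))
  cross-same {lab} {L} {s} {f} {g} F G =
    cut (All.zipWith (λ (p , q) → compatible-meet p q) (edges-ok F , edges-ok G))
        (λ e Tes eq → [ at-s F e Tes , at-s G e Tes ] (meet-far eq))
        (λ e t t≢s Tet eq → at-others F e t t≢s Tet (proj₁ (meet-near eq))) ,
    cut (All.zipWith (λ (p , q) → compatible-flip (compatible-meet (compatible-flip p) (compatible-flip q))) (edges-ok F , edges-ok G))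
        (λ e Tes eq → at-s F e Tes (flip-near (proj₁ (meet-near {flip (f (lab e))} (flip-far eq)))))
        (λ e t t≢s Tet eq → [ (λ r → at-others F e t t≢s Tet (flip-far r)) , (λ r → at-others G e t t≢s Tet (flip-far r)) ]
                              (meet-far {flip (f (lab e))} (flip-near eq)))

  -- Each terminal is on the far side of the other's cut, so one near side may be intersected with
  -- the other far side: the differences of the near sides are again cuts around `s` and `t`.
  cross-distinct : ∀ {lab L s t f g} → s ≢ t → Cut lab L s f → Cut lab L t g →
    Cut lab L s (λ i → meet (f i) (flip (g i))) × Cut lab L t (λ i → meet (flip (f i)) (g i))
  cross-distinct {lab} {L} {s} {t} {f} {g} s≢t F G =
    cut (All.zipWith (λ (p , q) → compatible-meet p (compatible-flip q)) (edges-ok F , edges-ok G))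
        (λ e Tes eq → [ at-s F e Tes , (λ r → at-others G e s s≢t Tes (flip-far r)) ] (meet-far eq))
        (λ e r r≢s Ter eq → at-others F e r r≢s Ter (proj₁ (meet-near eq))) ,
    cut (All.zipWith (λ (p , q) → compatible-meet (compatible-flip p) q) (edges-ok F , edges-ok G))
        (λ e Tet eq → [ (λ r → at-others F e t (s≢t ∘ sym) Tet (flip-far r)) , at-s G e Tet ] (meet-far {flip (f (lab e))} eq))
        (λ e r r≢t Ter eq → at-others G e r r≢t Ter (proj₂ (meet-near {flip (f (lab e))} eq)))

  addEdge : ∀ {lab L s f x y} → Compatible (f (lab x)) (f (lab y)) → Cut lab L s f → Cut lab ((x , y) ∷ L) s f
  addEdge c F = cut (c ∷ edges-ok F) (at-s F) (at-others F)

  dropEdge : ∀ {lab L s f x y} → Cut lab ((x , y) ∷ L) s f → Cut lab L s f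
  dropEdge F = cut (All.tail (edges-ok F)) (at-s F) (at-others F)

  weight-bound : ∀ (f g u v : Fin n → Side) → (∀ i → size (u i) + size (v i) ≤ size (f i) + size (g i)) →
    k ≤ weight u → k ≤ weight v → weight f < k → weight g ≤ k → ⊥
  weight-bound f g u v pointwise k≤u k≤v f<k g≤k = <-irrefl refl (begin-strict
    k + k                              ≤⟨ +-mono-≤ k≤u k≤v ⟩
    weight u + weight v                ≡⟨ ∑-distrib-+ (size ∘ u) (size ∘ v) ⟨
    ∑ (λ i → size (u i) + size (v i))  ≤⟨ ∑-mono-≤ pointwise ⟩
    ∑ (λ i → size (f i) + size (g i))  ≡⟨ ∑-distrib-+ (size ∘ f) (size ∘ g) ⟩
    weight f + weight g                <⟨ +-mono-<-≤ f<k g≤k ⟩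
    k + k                              ∎)
    where open ≤-Reasoning

  -- The end on the near side is pulled into `sep`, so the crossed colouring respects an edge that
  -- the first colouring violates.
  compatible-splitˡ : ∀ {a b c d} → Split a b → c ≡ sep → d ≡ sep → Compatible (meet a c) (meet b d)
  compatible-splitˡ (inj₁ (refl , refl)) refl refl = compatible-sepˡ _ refl
  compatible-splitˡ (inj₂ (refl , refl)) refl refl = compatible-sepʳ _ refl

  split-flip : ∀ {a b} → Split a b → Split (flip a) (flip b)
  split-flip (inj₁ (refl , refl)) = inj₂ (refl , refl)
  split-flip (inj₂ (refl , refl)) = inj₁ (refl , refl)

  -- Both crossed cuts respect the edge `(x , y)`, although `f` does not, because `g` has both ends
  -- in its separator. Robustness with that edge then gives each of them weight at least `k`, while
  -- together they weigh no more than `f` and `g`.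
  uncross : ∀ {lab L x y s t f g} → Robust lab ((x , y) ∷ L) →
    Cut lab L s f → weight f < k → Split (f (lab x)) (f (lab y)) →
    Cut lab ((x , y) ∷ L) t g → weight g ≤ k → g (lab x) ≡ sep → g (lab y) ≡ sep → ⊥
  uncross {lab} {L} {x} {y} {s} {t} {f} {g} robust F f<k split G g≤k gx gy with s ≟ᴵ t
  ... | yes refl =
    let U , V = cross-same F (dropEdge G) in
    weight-bound f g _ _ pointwise
      (robust s _ (addEdge (compatible-splitˡ split gx gy) U))
      (robust s _ (addEdge (compatible-flip (compatible-splitˡ (split-flip split) (cong flip gx) (cong flip gy))) V))
      f<k g≤k
    where
    pointwise : ∀ i → size (meet (f i) (g i)) + size (flip (meet (flip (f i)) (flip (g i)))) ≤ size (f i) + size (g i)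
    pointwise i rewrite size-flip (meet (flip (f i)) (flip (g i))) = size-uncross (f i) (g i)
  ... | no s≢t =
    let U , V = cross-distinct s≢t F (dropEdge G) in
    weight-bound f g _ _ pointwise
      (robust s _ (addEdge (compatible-splitˡ split (cong flip gx) (cong flip gy)) U))
      (robust t _ (addEdge (compatible-splitˡ (split-flip split) gx gy) V))
      f<k g≤k
    where
    flip-flip : ∀ a → flip (flip a) ≡ a
    flip-flip near = refl
    flip-flip sep  = refl
    flip-flip far  = refl
    pointwise : ∀ i → size (meet (f i) (flip (g i))) + size (meet (flip (f i)) (g i)) ≤ size (f i) + size (g i)
    pointwise i = subst (λ c → size (meet (f i) (flip (g i))) + size (meet (flip (f i)) c) ≤ size (f i) + size (g i))
      (flip-flip (g i))
      (subst (λ m → size (meet (f i) (flip (g i))) + size (meet (flip (f i)) (flip (flip (g i)))) ≤ size (f i) + m)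
        (size-flip (g i)) (size-uncross (f i) (flip (g i))))

  unmerge : ∀ {lab L s g} p q → Cut (merge p q ∘ lab) L s g → Cut lab L s (g ∘ merge p q)
  unmerge p q G = cut (edges-ok G) (at-s G) (at-others G)

  -- Only the label `q` is recoloured, with the colour of `p`. Undoing a contraction thus costs at
  -- most 1, which is why `uncross` asks for `weight g ≤ k` but for `weight f < k`.
  weight-unmerge : ∀ (g : Fin n → Side) p q → weight (g ∘ merge p q) ≤ size (g p) + weight g
  weight-unmerge g p q = begin
    weight (g ∘ merge p q)                                             ≤⟨ ∑-mono-≤ pointwise ⟩
    ∑ (λ i → (if does (i ≟ q) then size (g p) else 0) + size (g i))    ≡⟨ ∑-distrib-+ _ (size ∘ g) ⟩
    ∑ (λ i → if does (i ≟ q) then size (g p) else 0) + weight g        ≤⟨ +-monoˡ-≤ (weight g) (∑-at-≤ q (size (g p))) ⟩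
    size (g p) + weight g                                              ∎
    where
    open ≤-Reasoning
    pointwise : ∀ i → size (g (merge p q i)) ≤ (if does (i ≟ q) then size (g p) else 0) + size (g i)
    pointwise i with i ≟ q
    ... | yes _ = m≤m+n _ _
    ... | no  _ = ≤-refl

  -- Hind–Oellermann: an edge between two blocks can be deleted or contracted. A cut that
  -- appears on deletion has the blocks p, q on opposite sides, one that appears on contraction
  -- has both in the separator; uncrossing the two gives two cuts of total weight below 2 k.
  delete-or-contract : ∀ {lab L x y} → Robust lab ((x , y) ∷ L) →
    ¬ Robust lab L → ¬ Robust (merge (lab x) (lab y) ∘ lab) L → ⊥
  delete-or-contract {lab} {L} {x} {y} robust ¬deletable ¬contractible =
    ¬deletable λ s f F → decidable-stable (k ≤? weight f) λ k≰f →
    ¬contractible λ t g G → decidable-stable (k ≤? weight g) λ k≰g →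
    contradict F (≰⇒> k≰f) G (≰⇒> k≰g)
    where
    p = lab x
    q = lab y
    -- With the merged block outside the separator, undoing the contraction is free and gives both
    -- ends of the edge one colour: the result is a cut that existed before.
    unseparated : ∀ {t g a} → Cut (merge p q ∘ lab) L t g → a ≢ sep → g p ≡ a → k ≤ weight g
    unseparated {t} {g} {a} G a≢sep refl = ≤-trans (robust t _ (addEdge same (unmerge p q G)))
      (subst (λ m → weight (g ∘ merge p q) ≤ m + weight g) (no-size (g p) a≢sep) (weight-unmerge g p q))
      where
      no-size : ∀ a → a ≢ sep → size a ≡ 0
      no-size near _     = refl
      no-size sep  a≢sep = contradiction refl a≢sep
      no-size far  _     = refl
      same : Compatible (g (merge p q p)) (g (merge p q q))
      same rewrite merge-fix p q | merge-≡ p q =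
        (λ (n , f) → case trans (sym n) f of λ ()) , (λ (f , n) → case trans (sym n) f of λ ())
    contradict : ∀ {s t f g} → Cut lab L s f → weight f < k → Cut (merge p q ∘ lab) L t g → weight g < k → ⊥
    contradict {s} {t} {f} {g} F f<k G g<k with compatible? (f p) (f q)
    ... | inj₁ c     = <⇒≱ f<k (robust s f (addEdge c F))
    ... | inj₂ split with g p in gp
    ...   | sep  = uncross robust F f<k split (addEdge (compatible-sepˡ _ g′p) (unmerge p q G))
                     (≤-trans (weight-unmerge g p q) (subst (λ a → size a + weight g ≤ k) (sym gp) g<k)) g′p g′q
      where
      g′p = trans (cong g (merge-fix p q)) gp
      g′q = trans (cong g (merge-≡ p q)) gp
    ...   | near = <⇒≱ g<k (unseparated G (λ ()) gp)
    ...   | far  = <⇒≱ g<k (unseparated G (λ ()) gp)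

  -- Each edge in turn is deleted or contracted. Connectedness of blocks refers to the fixed
  -- relation `R` and not to the shrinking list, so blocks formed earlier survive later deletions.
  -- Once the list is empty, every colouring that respects the terminals is a cut.
  reduce : ∀ {R : Fin n → Fin n → Set} → (∀ {x y} → R x y → R y x) →
    ∀ L lab → All (λ (x , y) → R x y) L → Robust lab L → ConnectedBlocks R lab →
    ¬ ¬ (∃ λ lab′ → Robust lab′ [] × ConnectedBlocks R lab′)
  reduce R-sym []            lab []        robust conn ¬∃ = ¬∃ (lab , robust , conn)
  reduce R-sym ((x , y) ∷ L) lab (r ∷ rs)  robust conn ¬∃ = delete-or-contract robust
    (λ robust′ → reduce R-sym L lab rs robust′ conn ¬∃)
    (λ robust′ → reduce R-sym L (merge (lab x) (lab y) ∘ lab) rs robust′ (merge-connected R-sym r conn) ¬∃)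

-- From vertex connectivity to the element cuts of three terminals

does-true : ∀ {P : Set} (P? : Dec P) → does P? ≡ true → P
does-true (yes p) _ = p

module _ {n : ℕ} {P : Fin n → Set} (P? : Decidable P) where

  ⟨_⟩ : Subset n
  ⟨_⟩ = Vec.tabulate (does ∘ P?)

  ∈⟨⟩⁺ : ∀ {x} → P x → x ∈ ⟨_⟩
  ∈⟨⟩⁺ {x} Px = lookup⇒[]= x _ (trans (lookup∘tabulate (does ∘ P?) x) (dec-true (P? x) Px))

  ∈⟨⟩⁻ : ∀ {x} → x ∈ ⟨_⟩ → P x
  ∈⟨⟩⁻ {x} x∈ = does-true (P? x) (trans (sym (lookup∘tabulate (does ∘ P?) x)) ([]=⇒lookup x∈))

  ∣⟨⟩∣ : ∣ ⟨_⟩ ∣ ≡ # (does ∘ P?)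
  ∣⟨⟩∣ = trans (∣∣≡# ⟨_⟩) (sum-cong-≗ λ i → cong ind (lookup∘tabulate (does ∘ P?) i))

walk-start : ∀ {n} {X : Subset n} {E u v} → Walk X E u v → u ∈ X
walk-start (here u∈X)     = u∈X
walk-start (step u∈X _ _) = u∈X

walk-invariant : ∀ {n} {X : Subset n} {E} (P : Fin n → Set) →
  (∀ {u w} → P u → w ∈ X → E u w ≡ true → P w) → ∀ {u v} → Walk X E u v → P u → P v
walk-invariant P next (here _)      Pu = Pu
walk-invariant P next (step _ e w) Pu = walk-invariant P next w (next Pu (walk-start w) e)

transposeˡ : ∀ {n} (i j : Fin n) → transpose i j ⟨$⟩ʳ i ≡ j
transposeˡ i j rewrite dec-true (i ≟ i) refl = refl

transposeʳ : ∀ {n} (i j : Fin n) → transpose i j ⟨$⟩ʳ j ≡ i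
transposeʳ i j with j ≟ i
... | yes j≡i = j≡i
... | no  _ rewrite dec-true (j ≟ j) refl = refl

transpose-fix : ∀ {n} (i j : Fin n) {v} → v ≢ i → v ≢ j → transpose i j ⟨$⟩ʳ v ≡ v
transpose-fix i j {v} v≢i v≢j rewrite dec-false (v ≟ i) v≢i | dec-false (v ≟ j) v≢j = refl

others : ∀ (s : Fin 3) → ∃₂ λ t r → t ≢ s × r ≢ s × t ≢ r × (∀ j → j ≡ s ⊎ j ≡ t ⊎ j ≡ r)
others 0F = 1F , 2F , (λ ()) , (λ ()) , (λ ()) , λ { 0F → inj₁ refl ; 1F → inj₂ (inj₁ refl) ; 2F → inj₂ (inj₂ refl) }
others 1F = 0F , 2F , (λ ()) , (λ ()) , (λ ()) , λ { 1F → inj₁ refl ; 0F → inj₂ (inj₁ refl) ; 2F → inj₂ (inj₂ refl) }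
others 2F = 0F , 1F , (λ ()) , (λ ()) , (λ ()) , λ { 2F → inj₁ refl ; 0F → inj₂ (inj₁ refl) ; 1F → inj₂ (inj₂ refl) }

module Terminals {n : ℕ} (G : Graph n) (ter : Fin 3 → Fin n) (ter-injective : ∀ {i j} → ter i ≡ ter j → i ≡ j) where

  NonTerminal : Fin n → Set
  NonTerminal v = ∀ j → v ≢ ter j

  nonTerminal? : Decidable NonTerminal
  nonTerminal? v = all? λ j → ¬? (v ≟ ter j)

  terminal : ∀ {v} → ¬ NonTerminal v → ∃ λ j → v ≡ ter j
  terminal {v} ¬non = decidable-stable (any? λ j → v ≟ ter j) λ ¬∃ → ¬non λ j eq → ¬∃ (j , eq)

  adj? : ∀ u v → Dec (adj G u v ≡ true)
  adj? u v = adj G u v Bool.≟ true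

  adj-comm : ∀ {u v} → adj G u v ≡ true → adj G v u ≡ true
  adj-comm {u} {v} e = trans (adj-sym G v u) e

  -- Edges between terminals have to be subdivided: the vertex ter j, otherwise unused
  -- as an element, plays the subdivision vertex of the edge joining the other two terminals.
  Touches : Fin n → Fin 3 → Set
  Touches e s = NonTerminal e × adj G e (ter s) ≡ true
    ⊎ ∃₂ λ j i → e ≡ ter j × i ≢ j × s ≢ j × i ≢ s × adj G (ter i) (ter s) ≡ true

  touches? : ∀ e s → Dec (Touches e s)
  touches? e s = (nonTerminal? e ×-dec adj? e (ter s)) ⊎-dec
    any? λ j → any? λ i → e ≟ ter j ×-dec ¬? (i ≟ j) ×-dec ¬? (s ≟ j) ×-dec ¬? (i ≟ s) ×-dec adj? (ter i) (ter s)

  InnerEdge : Fin n → Fin n → Set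
  InnerEdge x y = NonTerminal x × NonTerminal y × adj G x y ≡ true

  innerEdge? : Decidable (λ ((x , y) : Fin n × Fin n) → InnerEdge x y)
  innerEdge? (x , y) = nonTerminal? x ×-dec nonTerminal? y ×-dec adj? x y

  innerEdge-sym : ∀ {x y} → InnerEdge x y → InnerEdge y x
  innerEdge-sym (x , y , e) = y , x , adj-comm e

  innerEdges : List (Fin n × Fin n)
  innerEdges = filter innerEdge? (cartesianProduct (allFin n) (allFin n))

  open Reduction {n} {Fin 3} _≟_ Touches

  module _ {k : ℕ} (κ : ∀ Q → DisconnectsOrTrivial G Q → k ≤ ∣ Q ∣) where

    -- An element cut becomes a vertex separator of no larger size when each edge inside `S` that it
    -- contains is exchanged for an end. Which end works depends on what is left on the far side, so
    -- two candidates `Q₁` and `Q₂` are tried.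
    robust-initially : Robust k id innerEdges
    robust-initially s f F = main (others s)
      where
      sep? : ∀ v → Dec (f v ≡ sep)
      sep? v with f v
      ... | near = no λ ()
      ... | sep  = yes refl
      ... | far  = no λ ()

      near? : ∀ v → Dec (f v ≡ near)
      near? v with f v
      ... | near = yes refl
      ... | sep  = no λ ()
      ... | far  = no λ ()

      neither : ∀ {v} → f v ≢ far → f v ≢ sep → f v ≡ near
      neither {v} ≢far ≢sep with f v
      ... | near = refl
      ... | sep  = contradiction refl ≢sep
      ... | far  = contradiction refl ≢far

      ∣⟨⟩∣≤weight : ∀ {P : Fin n → Set} (P? : Decidable P) (π : Permutation n n) →
        (∀ v → P v → f (π ⟨$⟩ʳ v) ≡ sep) → ∣ ⟨ P? ⟩ ∣ ≤ weight f
      ∣⟨⟩∣≤weight {P} P? π P⇒sep = begin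
        ∣ ⟨ P? ⟩ ∣                      ≡⟨ ∣⟨⟩∣ P? ⟩
        # (does ∘ P?)                   ≤⟨ ∑-mono-≤ pointwise ⟩
        ∑ (λ v → size (f (π ⟨$⟩ʳ v)))   ≡⟨ ∑-permute (size ∘ f) π ⟨
        weight f                        ∎
        where
        open ≤-Reasoning
        pointwise : ∀ v → ind (does (P? v)) ≤ size (f (π ⟨$⟩ʳ v))
        pointwise v with P? v
        ... | no  _  = z≤n
        ... | yes Pv rewrite P⇒sep v Pv = s≤s z≤n

      Near : Fin n → Set
      Near v = NonTerminal v × f v ≡ near

      -- An edge from `ter s` to another terminal is cut by removing its other end.
      Q₁ : Fin n → Set
      Q₁ v = NonTerminal v × f v ≡ sep ⊎ ∃ λ j → v ≡ ter j × j ≢ s × adj G (ter s) v ≡ true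

      q₁? : Decidable Q₁
      q₁? v = (nonTerminal? v ×-dec sep? v) ⊎-dec any? λ j → v ≟ ter j ×-dec ¬? (j ≟ s) ×-dec adj? (ter s) v

      -- Removing `ter s` cuts the same edges. This cuts the near vertices off from the other two
      -- terminals.
      Q₂ : Fin n → Set
      Q₂ v = NonTerminal v × f v ≡ sep ⊎ v ≡ ter s

      q₂? : Decidable Q₂
      q₂? v = (nonTerminal? v ×-dec sep? v) ⊎-dec (v ≟ ter s)

      near-next : ∀ {u w} → Near u → ¬ (NonTerminal w × f w ≡ sep) → adj G u w ≡ true → w ≡ ter s ⊎ Near w
      near-next {u} {w} (u-non , fu) w∉Q e with nonTerminal? w
      ... | yes w-non = inj₂ (w-non , neither
              (λ fw → proj₁ (All.lookup (Cut.edges-ok F) listed) (fu , fw)) (λ fw → w∉Q (w-non , fw)))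
        where
        listed : (u , w) ∈ˡ innerEdges
        listed = ∈-filter⁺ innerEdge? (∈-cartesianProduct⁺ (∈-allFin u) (∈-allFin w)) (u-non , w-non , e)
      ... | no ¬non with terminal ¬non
      ...   | j , refl with j ≟ s
      ...     | yes refl = inj₁ refl
      ...     | no  j≢s  = contradiction fu (Cut.at-others F u j j≢s (inj₁ (u-non , e)))

      s-next : ∀ {w} → ¬ Q₁ w → adj G (ter s) w ≡ true → w ≡ ter s ⊎ Near w
      s-next {w} w∉Q e with nonTerminal? w
      ... | yes w-non = inj₂ (w-non , neither (Cut.at-s F w (inj₁ (w-non , adj-comm e))) λ fw → w∉Q (inj₁ (w-non , fw)))
      ... | no ¬non with terminal ¬non
      ...   | j , refl with j ≟ s
      ...     | yes refl = inj₁ refl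
      ...     | no  j≢s  = contradiction (inj₂ (j , refl , j≢s , e)) w∉Q

      -- The element `ter r` stands for the edge between `ter s` and `ter t`. It touches `s`, hence
      -- is not far, and touches `t`, hence is not near.
      opposite-sep : ∀ {t r} → t ≢ s → r ≢ s → t ≢ r → adj G (ter s) (ter t) ≡ true → f (ter r) ≡ sep
      opposite-sep {t} {r} t≢s r≢s t≢r e = decidable-stable (sep? (ter r)) λ ≢sep →
        Cut.at-others F (ter r) t t≢s (inj₂ (r , s , refl , r≢s ∘ sym , t≢r , t≢s ∘ sym , e))
          (neither (Cut.at-s F (ter r) (inj₂ (r , t , refl , t≢r , r≢s ∘ sym , t≢s , adj-comm e))) ≢sep)

      main : (∃₂ λ t r → t ≢ s × r ≢ s × t ≢ r × (∀ j → j ≡ s ⊎ j ≡ t ⊎ j ≡ r)) → k ≤ weight f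
      main (t , r , t≢s , r≢s , t≢r , cover) = separate
        (any? λ v → ¬? (q₁? v) ×-dec ¬? (v ≟ ter s) ×-dec ¬? (nonTerminal? v ×-dec near? v))
        where
        -- The edge from `ter s` to `ter t` is the element `ter r`, and that to `ter r` is the
        -- element `ter t`; the transposition sends each removed terminal to the separator element
        -- that pays for it.
        small₁ : ∣ ⟨ q₁? ⟩ ∣ ≤ weight f
        small₁ = ∣⟨⟩∣≤weight q₁? (transpose (ter t) (ter r)) moved
          where
          moved : ∀ v → Q₁ v → f (transpose (ter t) (ter r) ⟨$⟩ʳ v) ≡ sep
          moved v (inj₁ (v-non , fv)) = trans (cong f (transpose-fix (ter t) (ter r) (v-non t) (v-non r))) fv
          moved v (inj₂ (j , refl , j≢s , e)) with cover j
          ... | inj₁ j≡s         = contradiction j≡s j≢s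
          ... | inj₂ (inj₁ refl) = trans (cong f (transposeˡ (ter t) (ter r))) (opposite-sep t≢s r≢s t≢r e)
          ... | inj₂ (inj₂ refl) = trans (cong f (transposeʳ (ter t) (ter r))) (opposite-sep r≢s t≢s (t≢r ∘ sym) e)

        -- Here `ter s` is paid for by the edge to `ter t`, which is the element `ter r`.
        small₂ : adj G (ter s) (ter t) ≡ true → ∣ ⟨ q₂? ⟩ ∣ ≤ weight f
        small₂ e = ∣⟨⟩∣≤weight q₂? (transpose (ter s) (ter r)) moved
          where
          moved : ∀ v → Q₂ v → f (transpose (ter s) (ter r) ⟨$⟩ʳ v) ≡ sep
          moved v (inj₁ (v-non , fv)) = trans (cong f (transpose-fix (ter s) (ter r) (v-non s) (v-non r))) fv
          moved v (inj₂ refl)         = trans (cong f (transposeˡ (ter s) (ter r))) (opposite-sep t≢s r≢s t≢r e)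

        ter-s∉Q₁ : ¬ Q₁ (ter s)
        ter-s∉Q₁ (inj₁ (non , _)) = non s refl
        ter-s∉Q₁ (inj₂ (j , eq , j≢s , _)) = j≢s (sym (ter-injective eq))

        separate : Dec (∃ λ v → ¬ Q₁ v × v ≢ ter s × ¬ Near v) → k ≤ weight f
        separate (yes (v , v∉Q₁ , v≢s , ¬near)) = ≤-trans (κ ⟨ q₁? ⟩ (inj₂ (ter s , v ,
            x∉p⇒x∈∁p (ter-s∉Q₁ ∘ ∈⟨⟩⁻ q₁?) , x∉p⇒x∈∁p (v∉Q₁ ∘ ∈⟨⟩⁻ q₁?) ,
            λ walk → [ v≢s , ¬near ] (walk-invariant (λ w → w ≡ ter s ⊎ Near w) next walk (inj₁ refl)))))
            small₁
          where
          next : ∀ {u w} → u ≡ ter s ⊎ Near u → w ∈ ∁ ⟨ q₁? ⟩ → adj G u w ≡ true → w ≡ ter s ⊎ Near w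
          next (inj₁ refl) w∈ e = s-next (x∈∁p⇒x∉p w∈ ∘ ∈⟨⟩⁺ q₁?) e
          next (inj₂ u-near) w∈ e = near-next u-near (x∈∁p⇒x∉p w∈ ∘ ∈⟨⟩⁺ q₁? ∘ inj₁) e
        separate (no none) with any? (λ v → nonTerminal? v ×-dec near? v)
        -- Outside `Q₁` only `ter s` and near vertices remain, so `Q₁` may fail to separate. But
        -- then `ter t` lies in `Q₁`, hence is adjacent to `ter s`, and this edge pays for `ter s`
        -- in `Q₂`.
        ... | yes (x , x-near@(x-non , fx)) = ≤-trans (κ ⟨ q₂? ⟩ (inj₂ (x , ter t ,
            x∉p⇒x∈∁p ([ (λ (_ , fx′) → case trans (sym fx) fx′ of λ ()) , x-non s ] ∘ ∈⟨⟩⁻ q₂?) ,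
            x∉p⇒x∈∁p ([ (λ (non , _) → non t refl) , t≢s ∘ ter-injective ] ∘ ∈⟨⟩⁻ q₂?) ,
            λ walk → proj₁ (walk-invariant Near next walk x-near) t refl)))
            (small₂ (t-adjacent (decidable-stable (q₁? (ter t)) λ t∉Q₁ →
              none (ter t , t∉Q₁ , t≢s ∘ ter-injective , λ (non , _) → non t refl))))
          where
          next : ∀ {u w} → Near u → w ∈ ∁ ⟨ q₂? ⟩ → adj G u w ≡ true → Near w
          next u-near w∈ e =
            [ (λ w≡s → contradiction (∈⟨⟩⁺ q₂? (inj₂ w≡s)) (x∈∁p⇒x∉p w∈)) , id ]
            (near-next u-near (x∈∁p⇒x∉p w∈ ∘ ∈⟨⟩⁺ q₂? ∘ inj₁) e)
          t-adjacent : Q₁ (ter t) → adj G (ter s) (ter t) ≡ true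
          t-adjacent (inj₁ (non , _))       = contradiction refl (non t)
          t-adjacent (inj₂ (_ , _ , _ , e)) = e
        -- Only `ter s` survives the removal of `Q₁`: the trivial case in the definition of
        -- connectivity.
        ... | no no-near = ≤-trans
            (κ ⟨ q₁? ⟩ (inj₁ (≤-trans (p⊆q⇒∣p∣≤∣q∣ only-s) (≤-reflexive (∣⁅x⁆∣≡1 (ter s)))))) small₁
          where
          only-s : ∁ ⟨ q₁? ⟩ ⊆ ⁅ ter s ⁆
          only-s {v} v∈ with v ≟ ter s
          ... | yes refl = x∈⁅x⁆ (ter s)
          ... | no  v≢s  = contradiction (v , x∈∁p⇒x∉p v∈ ∘ ∈⟨⟩⁺ q₁? , v≢s , λ v-near → no-near (v , v-near)) none

-- Spanning trees

walk-++ : ∀ {n} {X : Subset n} {E u v w} → Walk X E u v → Walk X E v w → Walk X E u w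
walk-++ (here _)      q = q
walk-++ (step u∈ e p) q = step u∈ e (walk-++ p q)

walk-reverse : ∀ {n} {X : Subset n} {E u v} → (∀ u v → E u v ≡ E v u) → Walk X E u v → Walk X E v u
walk-reverse E-sym (here u∈) = here u∈
walk-reverse E-sym (step {u} {w} u∈ e p) =
  walk-++ (walk-reverse E-sym p) (step (walk-start p) (trans (E-sym w u) e) (here u∈))

∑-mono-< : ∀ {n} {f g : Fin n → ℕ} → (∀ i → f i ≤ g i) → ∀ j → f j < g j → ∑ f < ∑ g
∑-mono-< f≤g zero    f<g = +-mono-<-≤ f<g (∑-mono-≤ (f≤g ∘ suc))
∑-mono-< f≤g (suc j) f<g = +-mono-≤-< (f≤g zero) (∑-mono-< (f≤g ∘ suc) j f<g)

≡-from-true : ∀ {b c} → (b ≡ true → c ≡ true) → (c ≡ true → b ≡ true) → b ≡ c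
≡-from-true {false} {false} _   _   = refl
≡-from-true {false} {true}  _   c⇒b = c⇒b refl
≡-from-true {true}  {c}     b⇒c _   = sym (b⇒c refl)

module SpanningTree {n : ℕ} (G : Graph n) (X : Subset n) where

  -- A `Subtree` on the vertex set `X`, except that cycles are allowed.
  record Spanning (E : Fin n → Fin n → Bool) : Set where
    field
      symmetric : ∀ u v → E u v ≡ E v u
      in-graph  : ∀ u v → E u v ≡ true → adj G u v ≡ true
      in-verts  : ∀ u v → E u v ≡ true → u ∈ X × v ∈ X
      joined    : ∀ u v → u ∈ X → v ∈ X → Walk X E u v
  open Spanning

  private
    edgeSum : (Fin n → Fin n → Bool) → ℕ
    edgeSum E = ∑ λ u → # (E u)

  module Deletion (E : Fin n → Fin n → Bool) (a b : Fin n) where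

    Deleted : Fin n → Fin n → Set
    Deleted u v = (u ≡ a × v ≡ b) ⊎ (u ≡ b × v ≡ a)

    deleted? : ∀ u v → Dec (Deleted u v)
    deleted? u v = (u ≟ a ×-dec v ≟ b) ⊎-dec (u ≟ b ×-dec v ≟ a)

    Kept : Fin n → Fin n → Set
    Kept u v = E u v ≡ true × ¬ Deleted u v

    kept? : ∀ u v → Dec (Kept u v)
    kept? u v = (E u v Bool.≟ true) ×-dec ¬? (deleted? u v)

    E⁻ : Fin n → Fin n → Bool
    E⁻ u v = does (kept? u v)

    kept : ∀ {u v} → E u v ≡ true → ¬ Deleted u v → E⁻ u v ≡ true
    kept {u} {v} e ¬d = dec-true (kept? u v) (e , ¬d)

    E⁻⊆E : ∀ u v → E⁻ u v ≡ true → E u v ≡ true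
    E⁻⊆E u v e = proj₁ (does-true (kept? u v) e)

    fewer : E a b ≡ true → edgeSum E⁻ < edgeSum E
    fewer e = ∑-mono-< (λ u → #-mono-≤ (E⁻ u) (E u) (E⁻⊆E u)) a
      (∑-mono-< (λ v → ind-mono-≤ (E⁻ a v) (E a v) (E⁻⊆E a v)) b
        (subst (λ c → ind (E⁻ a b) < ind c) (sym e)
          (s≤s (≤-reflexive (cong ind (dec-false (kept? a b) λ (_ , ¬d) → ¬d (inj₁ (refl , refl))))))))

    symmetric⁻ : Spanning E → ∀ u v → E⁻ u v ≡ E⁻ v u
    symmetric⁻ S u v = ≡-from-true mirror mirror
      where
      mirror : ∀ {u v} → E⁻ u v ≡ true → E⁻ v u ≡ true
      mirror {u} {v} e = let e′ , ¬d = does-true (kept? u v) e in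
        kept (trans (symmetric S v u) e′) λ { (inj₁ (p , q)) → ¬d (inj₂ (q , p)) ; (inj₂ (p , q)) → ¬d (inj₁ (q , p)) }

    spanning⁻ : Spanning E → Walk X E⁻ b a → Spanning E⁻
    spanning⁻ S detour = record
      { symmetric = symmetric⁻ S
      ; in-graph  = λ u v e → in-graph S u v (E⁻⊆E u v e)
      ; in-verts  = λ u v e → in-verts S u v (E⁻⊆E u v e)
      ; joined    = λ u v u∈ v∈ → reroute (joined S u v u∈ v∈)
      }
      where
      reroute : ∀ {u v} → Walk X E u v → Walk X E⁻ u v
      reroute (here u∈) = here u∈
      reroute (step {u} {w} u∈ e p) with deleted? u w
      ... | no  ¬d                   = step u∈ (kept e ¬d) (reroute p)
      ... | yes (inj₁ (refl , refl)) = walk-++ (walk-reverse (symmetric⁻ S) detour) (reroute p)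
      ... | yes (inj₂ (refl , refl)) = walk-++ detour (reroute p)

  cycle-detour : ∀ {E} → Spanning E → (C : Cycle E) → let m , c , _ = C in
    Walk X (Deletion.E⁻ E (c (fromℕ (suc (suc m)))) (c zero)) (c zero) (c (fromℕ (suc (suc m))))
  cycle-detour {E} S (m , c , c-inj , next , close) = <-weakInduction (λ i → Walk X E⁻ (c zero) (c i))
    (here (proj₂ (in-verts S _ _ close)))
    (λ i p → let u∈ , w∈ = in-verts S _ _ (next i) in walk-++ p (step u∈ (kept (next i) (not-deleted i)) (here w∈)))
    (fromℕ (suc (suc m)))
    where
    open Deletion E (c (fromℕ (suc (suc m)))) (c zero)
    -- The reversed closing edge could coincide with the first edge only on a cycle of two vertices;
    -- a `Cycle` has at least three.
    not-deleted : ∀ i → ¬ Deleted (c (inject₁ i)) (c (suc i))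
    not-deleted i (inj₁ (eq , _)) = fromℕ≢inject₁ (sym (c-inj eq))
    not-deleted zero (inj₂ (_ , eq)) with () ← suc-injective (c-inj eq)
    not-deleted (suc i) (inj₂ (eq , _)) with () ← c-inj eq

  spanningTree : ∀ {E} → Spanning E →
    ¬ ¬ (Σ (Subtree G) λ t → verts t ≡ X × (∀ u v → edges t u v ≡ true → E u v ≡ true))
  spanningTree {E} S = search (edgeSum E) S ≤-refl
    where
    search : ∀ m {E} → Spanning E → edgeSum E ≤ m →
      ¬ ¬ (Σ (Subtree G) λ t → verts t ≡ X × (∀ u v → edges t u v ≡ true → E u v ≡ true))
    search m {E} S E≤m ¬∃ = ¬∃ (record
      { verts = X ; edges = E ; edges-sym = symmetric S ; edges-in-G = in-graph S
      ; edges-in-verts = in-verts S ; connected = joined S ; acyclic = break m E≤m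
      } , refl , λ u v e → e)
      where
      break : ∀ m → edgeSum E ≤ m → ¬ Cycle E
      break zero    E≤m (l , c , _ , _ , close) = n≮0 (<-≤-trans (Deletion.fewer E _ _ close) E≤m)
      break (suc m) E≤m C@(l , c , _ , _ , close) =
        search m (spanning⁻ S (cycle-detour S C)) (≤-pred (<-≤-trans (fewer close) E≤m))
          λ (t , t≡X , t⊆) → ¬∃ (t , t≡X , λ u v e → E⁻⊆E u v (t⊆ u v e))
        where open Deletion E (c (fromℕ (suc (suc l)))) (c zero)

-- Trees from blocks

-- Lets spanning trees that exist one by one under double negation be chosen simultaneously.
¬¬-Π : ∀ {ℓ} {P : Fin ℓ → Set} → (∀ i → ¬ ¬ P i) → ¬ ¬ (∀ i → P i)
¬¬-Π {zero}  p ¬∀ = ¬∀ λ ()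
¬¬-Π {suc ℓ} p ¬∀ = p zero λ p₀ → ¬¬-Π (p ∘ suc) λ p₊ → ¬∀ λ { zero → p₀ ; (suc i) → p₊ i }

fin3-remaining : ∀ {i j k l : Fin 3} → i ≢ j → k ≢ i → k ≢ j → l ≢ i → l ≢ j → k ≡ l
fin3-remaining {i} {j} {k} {l} i≢j k≢i k≢j l≢i l≢j with others i
... | t , r , t≢i , r≢i , t≢r , cover with cover j | cover k | cover l
... | inj₁ j≡i | _ | _ = contradiction (sym j≡i) i≢j
... | _ | inj₁ k≡i | _ = contradiction k≡i k≢i
... | _ | _ | inj₁ l≡i = contradiction l≡i l≢i
... | inj₂ (inj₁ refl) | inj₂ (inj₁ refl) | _                = contradiction refl k≢j
... | inj₂ (inj₁ refl) | inj₂ (inj₂ refl) | inj₂ (inj₁ refl) = contradiction refl l≢j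
... | inj₂ (inj₁ refl) | inj₂ (inj₂ refl) | inj₂ (inj₂ refl) = refl
... | inj₂ (inj₂ refl) | inj₂ (inj₂ refl) | _                = contradiction refl k≢j
... | inj₂ (inj₂ refl) | inj₂ (inj₁ refl) | inj₂ (inj₂ refl) = contradiction refl l≢j
... | inj₂ (inj₂ refl) | inj₂ (inj₁ refl) | inj₂ (inj₁ refl) = refl

module Packing {n : ℕ} (G : Graph n) (ter : Fin 3 → Fin n) (ter-injective : ∀ {i j} → ter i ≡ ter j → i ≡ j)
  (lab : Fin n → Fin n) (blocks : ConnectedBlocks (Terminals.InnerEdge G ter ter-injective) lab) where

  open Terminals G ter ter-injective

  Meets : Fin n → Fin 3 → Set
  Meets i s = ∃ λ e → lab e ≡ i × Touches e s

  meets? : ∀ i s → Dec (Meets i s)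
  meets? i s = any? λ e → lab e ≟ i ×-dec touches? e s

  -- The blocks of one tree; the two labels coincide when a single block suffices.
  Bundle : Set
  Bundle = Fin n × Fin n

  Member : Fin n → Bundle → Set
  Member i (x , y) = i ≡ x ⊎ i ≡ y

  member? : ∀ i b → Dec (Member i b)
  member? i (x , y) = i ≟ x ⊎-dec i ≟ y

  -- No edge between the two blocks is asked for: they are joined at the terminal `h` that both
  -- meet.
  Good : Bundle → Set
  Good (x , y) = ∃ λ h → Meets x h × Meets y h × ∀ s → Meets x s ⊎ Meets y s

  Disjoint : Bundle → Bundle → Set
  Disjoint b b′ = ∀ i → Member i b → ¬ Member i b′

  -- An `InnerEdge` has no terminal end, so the only block path from `ter j` is the empty one.
  terminal-block : ∀ {j x} → lab (ter j) ≡ lab x → x ≡ ter j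
  terminal-block {j} {x} eq with blocks (ter j) x eq
  ... | ε                     = refl
  ... | (_ , non , _) ◅ _ = contradiction refl (non j)

  same-block-nonTerminal : ∀ {x y} → lab x ≡ lab y → NonTerminal x → NonTerminal y
  same-block-nonTerminal {x} eq non j refl = non j (terminal-block (sym eq))

  InTree : Bundle → Fin n → Set
  InTree b v = (∃ λ j → v ≡ ter j) ⊎ Member (lab v) b

  inTree? : ∀ b v → Dec (InTree b v)
  inTree? b v = any? (λ j → v ≟ ter j) ⊎-dec member? (lab v) b

  -- Every tree contains all terminals, so an edge between two of them must be assigned to one tree.
  -- The last condition gives it to the bundle that owns its subdivision element, which is the third
  -- terminal `ter k`.
  TreeEdge : Bundle → Fin n → Fin n → Set
  TreeEdge b u v = adj G u v ≡ true × InTree b u × InTree b v ×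
    (∀ i j → u ≡ ter i → v ≡ ter j → ∃ λ k → k ≢ i × k ≢ j × Member (lab (ter k)) b)

  treeEdge? : ∀ b u v → Dec (TreeEdge b u v)
  treeEdge? b u v = adj? u v ×-dec inTree? b u ×-dec inTree? b v ×-dec
    all? λ i → all? λ j → u ≟ ter i →-dec (v ≟ ter j →-dec any? λ k →
      ¬? (k ≟ i) ×-dec ¬? (k ≟ j) ×-dec member? (lab (ter k)) b)

  treeEdge-sym : ∀ {b u v} → TreeEdge b u v → TreeEdge b v u
  treeEdge-sym (e , u∈ , v∈ , third) = adj-comm e , v∈ , u∈ , λ i j v≡ u≡ →
    let k , k≢j , k≢i , mem = third j i u≡ v≡ in k , k≢i , k≢j , mem

  ⟦_⟧ : Bundle → Subset n
  ⟦ b ⟧ = ⟨ inTree? b ⟩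

  treeEdges : Bundle → Fin n → Fin n → Bool
  treeEdges b u v = does (treeEdge? b u v)

  treeEdges⁻ : ∀ b u v → treeEdges b u v ≡ true → TreeEdge b u v
  treeEdges⁻ b u v = does-true (treeEdge? b u v)

  treeEdges⁺ : ∀ b u v → TreeEdge b u v → treeEdges b u v ≡ true
  treeEdges⁺ b u v = dec-true (treeEdge? b u v)

  module _ (b : Bundle) where

    Path : Fin n → Fin n → Set
    Path = Star (TreeEdge b)

    block-path : ∀ {x y} → Member (lab x) b → BlockPath InnerEdge lab x y → Path x y
    block-path mem ε = ε
    block-path mem ((same , x-non , y-non , e) ◅ p) =
      (e , inj₂ mem , inj₂ mem′ , λ i j x≡ → contradiction x≡ (x-non i)) ◅ block-path mem′ p
      where mem′ = subst (λ i → Member i b) same mem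

    touch-edge : ∀ {e s} → Member (lab e) b → NonTerminal e → Touches e s → TreeEdge b e (ter s)
    touch-edge mem non (inj₁ (_ , e~s)) = e~s , inj₂ mem , inj₁ (_ , refl) , λ i j e≡ → contradiction e≡ (non i)
    touch-edge mem non (inj₂ (j , _ , e≡ , _)) = contradiction e≡ (non j)

    -- A block of ordinary vertices is crossed by an inner path. A block consisting of a subdivision
    -- element stands for an edge inside `S`, and distinct terminals that it meets are the ends of
    -- that edge.
    terminal-path : ∀ {i s t} → Member i b → Meets i s → Meets i t → Path (ter s) (ter t)
    terminal-path {s = s} {t} mem (e , refl , e~s) (e′ , same , e′~t) with nonTerminal? e
    ... | yes non = treeEdge-sym (touch-edge mem non e~s) ◅
            block-path mem (blocks e e′ (sym same)) ◅◅
            touch-edge (subst (λ i → Member i b) (sym same) mem) (same-block-nonTerminal (sym same) non) e′~t ◅ ε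
    ... | no ¬non with terminal ¬non
    ...   | j , refl with terminal-block (sym same)
    ...     | refl = direct e~s e′~t
      where
      direct : Touches (ter j) s → Touches (ter j) t → Path (ter s) (ter t)
      direct (inj₁ (non , _)) _ = contradiction refl (non j)
      direct _ (inj₁ (non , _)) = contradiction refl (non j)
      direct (inj₂ (j₁ , i , eq₁ , i≢j , s≢j , i≢s , i~s)) (inj₂ (j₂ , _ , eq₂ , _ , t≢j , _))
        with refl ← ter-injective eq₁ | refl ← ter-injective eq₂ with s ≟ t
      ... | yes refl = ε
      ... | no s≢t with refl ← fin3-remaining s≢j (s≢t ∘ sym) t≢j i≢s i≢j =
        (adj-comm i~s , inj₁ (s , refl) , inj₁ (t , refl) , third) ◅ ε
        where
        third : ∀ p q → ter s ≡ ter p → ter t ≡ ter q → ∃ λ k → k ≢ p × k ≢ q × Member (lab (ter k)) b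
        third p q s≡p t≡q with refl ← ter-injective s≡p | refl ← ter-injective t≡q =
          j , s≢j ∘ sym , t≢j ∘ sym , mem

    module _ (good : Good b) where

      hub = proj₁ good

      member-meets-hub : ∀ {i} → Member i b → Meets i hub
      member-meets-hub (inj₁ refl) = proj₁ (proj₂ good)
      member-meets-hub (inj₂ refl) = proj₁ (proj₂ (proj₂ good))

      to-hub : ∀ v → InTree b v → Path v (ter hub)
      to-hub v v∈ with nonTerminal? v
      ... | no ¬non with terminal ¬non
      ...   | s , refl with proj₂ (proj₂ (proj₂ good)) s
      ...     | inj₁ m = terminal-path (inj₁ refl) m (member-meets-hub (inj₁ refl))
      ...     | inj₂ m = terminal-path (inj₂ refl) m (member-meets-hub (inj₂ refl))
      to-hub v (inj₁ (j , v≡)) | yes non = contradiction v≡ (non j)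
      to-hub v (inj₂ mem)      | yes non with member-meets-hub mem
      ... | e , same , e~h = block-path mem (blocks v e (sym same)) ◅◅
            touch-edge (subst (λ i → Member i b) (sym same) mem) (same-block-nonTerminal (sym same) non) e~h ◅ ε

      path-walk : ∀ {u v} → InTree b u → Path u v → Walk ⟦ b ⟧ (treeEdges b) u v
      path-walk u∈ ε = here (∈⟨⟩⁺ (inTree? b) u∈)
      path-walk u∈ (_◅_ {i = u} {j = w} e@(_ , _ , w∈ , _) p) = step (∈⟨⟩⁺ (inTree? b) u∈) (treeEdges⁺ b u w e) (path-walk w∈ p)

      bundle-spanning : SpanningTree.Spanning G ⟦ b ⟧ (treeEdges b)
      bundle-spanning = record
        { symmetric = edges-symmetric
        ; in-graph  = λ u v e → proj₁ (treeEdges⁻ b u v e)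
        ; in-verts  = λ u v e → let _ , u∈ , v∈ , _ = treeEdges⁻ b u v e in ∈⟨⟩⁺ (inTree? b) u∈ , ∈⟨⟩⁺ (inTree? b) v∈
        ; joined    = λ u v u∈ v∈ → walk-++ (reach-hub u u∈) (walk-reverse edges-symmetric (reach-hub v v∈))
        }
        where
        edges-symmetric : ∀ u v → treeEdges b u v ≡ treeEdges b v u
        edges-symmetric u v = ≡-from-true
          (treeEdges⁺ b v u ∘ treeEdge-sym ∘ treeEdges⁻ b u v) (treeEdges⁺ b u v ∘ treeEdge-sym ∘ treeEdges⁻ b v u)
        reach-hub : ∀ u → u ∈ ⟦ b ⟧ → Walk ⟦ b ⟧ (treeEdges b) u (ter hub)
        reach-hub u u∈ = path-walk (∈⟨⟩⁻ (inTree? b) u∈) (to-hub u (∈⟨⟩⁻ (inTree? b) u∈))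

  disjoint-inTree : ∀ {b b′ v} → Disjoint b b′ → InTree b v → InTree b′ v → ∃ λ j → v ≡ ter j
  disjoint-inTree dis (inj₁ t)   _          = t
  disjoint-inTree dis (inj₂ _)   (inj₁ t)   = t
  disjoint-inTree dis (inj₂ mem) (inj₂ mem′) = contradiction mem′ (dis _ mem)

  adjacent-distinct : ∀ {i j} → adj G (ter i) (ter j) ≡ true → i ≢ j
  adjacent-distinct e refl = case trans (sym e) (irrefl G _) of λ ()

  -- Disjoint bundles share only terminals, so a common edge lies inside `S`; both bundles would
  -- then own the label of the one remaining terminal.
  disjoint-edges : ∀ {b b′ u v} → Disjoint b b′ → TreeEdge b u v → ¬ TreeEdge b′ u v
  disjoint-edges dis (e , u∈ , v∈ , third) (_ , u∈′ , v∈′ , third′)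
    with disjoint-inTree dis u∈ u∈′ | disjoint-inTree dis v∈ v∈′
  ... | i , refl | j , refl with third i j refl refl | third′ i j refl refl
  ... | k , k≢i , k≢j , mem | k′ , k′≢i , k′≢j , mem′
    with refl ← fin3-remaining (adjacent-distinct e) k≢i k≢j k′≢i k′≢j = dis _ mem mem′

  packing : ∀ {S : Subset n} → (∀ {v} → v ∈ S → ∃ λ j → v ≡ ter j) → (∀ j → ter j ∈ S) →
    ∀ {ℓ} (b : Fin ℓ → Bundle) → (∀ i → Good (b i)) → (∀ i j → i ≢ j → Disjoint (b i) (b j)) →
    ¬ ¬ TreePacking G S ℓ
  packing {S} S⊆ter ter⊆S b good disjoint ¬packing =
    ¬¬-Π (λ i → SpanningTree.spanningTree G ⟦ b i ⟧ (bundle-spanning (b i) (good i))) λ t →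
    ¬packing record
      { tree = λ i → proj₁ (t i)
      ; connects = λ i {v} v∈S → subst (v ∈_) (sym (proj₁ (proj₂ (t i)))) (∈⟨⟩⁺ (inTree? (b i)) (inj₁ (S⊆ter v∈S)))
      ; edge-disjoint = λ i j i≢j u v e → ≡-from-true
          (λ e′ → contradiction (treeEdges⁻ (b j) u v (proj₂ (proj₂ (t j)) u v e′))
            (disjoint-edges (disjoint i j i≢j) (treeEdges⁻ (b i) u v (proj₂ (proj₂ (t i)) u v e)))) (λ ())
      ; vert-meet = λ i j i≢j v v∈i v∈j →
          let k , v≡ = disjoint-inTree (disjoint i j i≢j) (inTree (t i) v∈i) (inTree (t j) v∈j) in
          subst (_∈ S) (sym v≡) (ter⊆S k)
      }
    where
    inTree : ∀ {b v} →
      (T : Σ (Subtree G) λ t → verts t ≡ ⟦ b ⟧ × (∀ u v → edges t u v ≡ true → treeEdges b u v ≡ true)) →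
      v ∈ verts (proj₁ T) → InTree b v
    inTree {b} {v} (t , eq , _) v∈ = ∈⟨⟩⁻ (inTree? b) (subst (v ∈_) eq v∈)

-- Choosing disjoint pairs of blocks

-- A block meeting all three terminals has kind nothing, one meeting all but terminal j has kind just j.
Kind : Set
Kind = Maybe (Fin 3)

_≟ᴷ_ : (c d : Kind) → Dec (c ≡ d)
_≟ᴷ_ = ≡-dec _≟_

-- A tree is made of one block of kind nothing, or of two blocks of distinct kinds just t, just r;
-- in the latter case it is named after the terminal l ∉ {t , r}, which both blocks meet.
use : Kind → Kind → ℕ
use nothing  c = ind (does (c ≟ᴷ nothing))
use (just l) c = let t , r , _ = others l in ind (does (c ≟ᴷ just t)) + ind (does (c ≟ᴷ just r))

demand : Kind → List Kind → ℕ
demand c []       = 0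
demand c (d ∷ ds) = use d c + demand c ds

demand-++ : ∀ c ds es → demand c (ds ++ es) ≡ demand c ds + demand c es
demand-++ c []       es = refl
demand-++ c (d ∷ ds) es = trans (cong (use d c +_) (demand-++ c ds es)) (sym (+-assoc (use d c) _ _))

demand-replicate : ∀ c m d → demand c (replicate m d) ≡ m * use d c
demand-replicate c zero    d = refl
demand-replicate c (suc m) d = cong (use d c +_) (demand-replicate c m d)

use-hub : ∀ l c → use (just l) (just c) ≤ ind (not (does (c ≟ l)))
use-hub = toWitness {a? = all? λ l → all? λ c → use (just l) (just c) ≤? ind (not (does (c ≟ l)))} tt

demand-hubs : ∀ (hs : List (Fin 3)) → demand nothing (map just hs) ≡ 0
demand-hubs []       = refl
demand-hubs (h ∷ hs) = demand-hubs hs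

hubs-replicate : ∀ (x : Fin 3 → ℕ) m l → (∀ c → c ≢ l → m ≤ x c) → ∀ c → demand (just c) (map just (replicate m l)) ≤ x c
hubs-replicate x m l m≤ c = begin
  demand (just c) (map just (replicate m l))   ≡⟨ cong (demand (just c)) (map-replicate m) ⟩
  demand (just c) (replicate m (just l))       ≡⟨ demand-replicate (just c) m (just l) ⟩
  m * use (just l) (just c)                    ≤⟨ *-monoʳ-≤ m (use-hub l c) ⟩
  m * ind (not (does (c ≟ l)))                 ≤⟨ bound ⟩
  x c                                          ∎
  where
  open ≤-Reasoning
  map-replicate : ∀ m → map just (replicate m l) ≡ replicate m (just l)
  map-replicate zero    = refl
  map-replicate (suc m) = cong (just l ∷_) (map-replicate m)
  bound : m * ind (not (does (c ≟ l))) ≤ x c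
  bound with c ≟ l
  ... | yes _   = ≤-trans (≤-reflexive (*-zeroʳ m)) z≤n
  ... | no  c≢l = ≤-trans (≤-reflexive (*-identityʳ m)) (m≤ c c≢l)

choose-hubs : ∀ (x : Fin 3 → ℕ) j → j ≤ 5 → (∀ c c′ → c ≢ c′ → j ≤ x c + x c′) →
  ∃ λ hs → j ∸ 1 ≤ length hs × (∀ c → demand (just c) (map just hs) ≤ x c)
choose-hubs x j j≤5 j≤ with any? (λ c → x c ≤? 1)
-- With at most one block of kind `just l`, each of the other two kinds has at least `j ∸ 1` blocks,
-- and these are paired with each other.
... | yes (l , xl≤1) = replicate (j ∸ 1) l , ≤-reflexive (sym (length-replicate (j ∸ 1))) ,
    hubs-replicate x (j ∸ 1) l λ c c≢l → m≤n+o⇒m∸n≤o j 1 (≤-trans (j≤ l c (c≢l ∘ sym)) (+-monoˡ-≤ (x c) xl≤1))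
... | no ≰1 with j ≤? 4
-- Every kind now has at least two blocks: one pair of each sort makes three trees and uses every
-- kind exactly twice.
...   | yes j≤4 = 0F ∷ 1F ∷ 2F ∷ [] , ∸-monoˡ-≤ 1 j≤4 , λ c → ≤-trans (two c) (≰⇒> λ x≤1 → ≰1 (c , x≤1))
  where
  two : ∀ c → demand (just c) (map just (0F ∷ 1F ∷ 2F ∷ [])) ≤ 2
  two = toWitness {a? = all? λ c → demand (just c) (map just (0F ∷ 1F ∷ 2F ∷ [])) ≤? 2} tt
-- For `j = 5` at most one kind has fewer than three blocks. With `l` chosen as that kind, the other
-- two have a third block each, which form the fourth pair.
...   | no  j≰4 = let l , ≥3 = large (any? λ c → x c ≤? 2) in
    l ∷ 0F ∷ 1F ∷ 2F ∷ [] , ∸-monoˡ-≤ 1 j≤5 , λ c → ≤-trans (two+ l c) (enough l ≥3 c)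
  where
  two+ : ∀ l c → demand (just c) (map just (l ∷ 0F ∷ 1F ∷ 2F ∷ [])) ≤ ind (not (does (c ≟ l))) + 2
  two+ = toWitness {a? = all? λ l → all? λ c →
    demand (just c) (map just (l ∷ 0F ∷ 1F ∷ 2F ∷ [])) ≤? ind (not (does (c ≟ l))) + 2} tt
  large : Dec (∃ λ c → x c ≤ 2) → ∃ λ l → ∀ c → c ≢ l → 3 ≤ x c
  large (yes (l , xl≤2)) = l , λ c c≢l →
    +-cancelˡ-≤ 2 3 (x c) (≤-trans (≰⇒> j≰4) (≤-trans (j≤ l c (c≢l ∘ sym)) (+-monoˡ-≤ (x c) xl≤2)))
  large (no ≰2)          = 0F , λ c _ → ≰⇒> λ x≤2 → ≰2 (c , x≤2)
  enough : ∀ l → (∀ c → c ≢ l → 3 ≤ x c) → ∀ c → ind (not (does (c ≟ l))) + 2 ≤ x c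
  enough l ≥3 c with c ≟ l
  ... | yes _   = ≰⇒> λ x≤1 → ≰1 (c , x≤1)
  ... | no  c≢l = ≥3 c c≢l

-- Every block of kind `nothing` becomes a tree of its own. That lowers the requirement on the pairs
-- from `k` to `k ∸ F`, truncated to 0 if full blocks alone suffice.
meet-demand : ∀ (supply : Kind → ℕ) {k} → k ≤ 5 →
  (∀ t r → t ≢ r → k ≤ supply nothing + (supply (just t) + supply (just r))) →
  ∃ λ ds → k ∸ 1 ≤ length ds × (∀ c → demand c ds ≤ supply c)
meet-demand supply {k} k≤5 pairs = plan (choose-hubs (supply ∘ just) (k ∸ F) (≤-trans (m∸n≤m k F) k≤5)
    λ t r t≢r → m≤n+o⇒m∸n≤o k F (pairs t r t≢r))
  where
  F = supply nothing
  plan : (∃ λ hs → k ∸ F ∸ 1 ≤ length hs × (∀ c → demand (just c) (map just hs) ≤ supply (just c))) →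
    ∃ λ ds → k ∸ 1 ≤ length ds × (∀ c → demand c ds ≤ supply c)
  plan (hs , long , fit) = replicate F nothing ++ map just hs , long⁺ , fit⁺
    where
    long⁺ : k ∸ 1 ≤ length (replicate F nothing ++ map just hs)
    long⁺ = begin
      k ∸ 1                 ≤⟨ m≤n+m∸n (k ∸ 1) F ⟩
      F + (k ∸ 1 ∸ F)       ≡⟨ cong (F +_) (trans (∸-+-assoc k 1 F) (trans (cong (k ∸_) (+-comm 1 F)) (sym (∸-+-assoc k F 1)))) ⟩
      F + (k ∸ F ∸ 1)       ≤⟨ +-monoʳ-≤ F long ⟩
      F + length hs         ≡⟨ cong₂ _+_ (length-replicate F) (length-map just hs) ⟨
      length (replicate F nothing) + length (map just hs) ≡⟨ length-++ (replicate F nothing) ⟨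
      length (replicate F nothing ++ map just hs) ∎
      where open ≤-Reasoning
    fit⁺ : ∀ c → demand c (replicate F nothing ++ map just hs) ≤ supply c
    fit⁺ nothing rewrite demand-++ nothing (replicate F nothing) (map just hs) | demand-hubs hs
      | demand-replicate nothing F nothing | *-identityʳ F | +-identityʳ F = ≤-refl
    fit⁺ (just c) rewrite demand-++ (just c) (replicate F nothing) (map just hs)
      | demand-replicate (just c) F nothing | *-zeroʳ F = fit c

third-terminal : ∀ {t r : Fin 3} → t ≢ r → ∃ λ s → ∀ j → j ≡ s ⊎ j ≡ t ⊎ j ≡ r
third-terminal {t} {r} t≢r with others t
... | a , b , _ , _ , _ , cover with cover r
... | inj₁ r≡t         = contradiction (sym r≡t) t≢r
... | inj₂ (inj₁ refl) = b , λ j → [ inj₂ ∘ inj₁ , [ inj₂ ∘ inj₂ , inj₁ ] ] (cover j)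
... | inj₂ (inj₂ refl) = a , λ j → [ inj₂ ∘ inj₁ , [ inj₁ , inj₂ ∘ inj₂ ] ] (cover j)

enumerate : ∀ {n} (S : Subset n) → ∃ λ (e : Fin ∣ S ∣ → Fin n) →
  (∀ {i j} → e i ≡ e j → i ≡ j) × (∀ {v} → v ∈ S → ∃ λ j → v ≡ e j) × (∀ j → e j ∈ S)
enumerate Vec.[] = (λ ()) , (λ { {()} }) , (λ ()) , λ ()
enumerate (true Vec.∷ S) =
  let e , inj , onto , into = enumerate S in
  (λ { zero → zero ; (suc j) → suc (e j) }) ,
  (λ { {zero} {zero} _ → refl ; {suc i} {suc j} eq → cong suc (inj (suc-injective eq)) }) ,
  (λ { Vec.here → zero , refl ; (Vec.there v∈) → let j , eq = onto v∈ in suc j , cong suc eq }) ,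
  λ { zero → Vec.here ; (suc j) → Vec.there (into j) }
enumerate (false Vec.∷ S) =
  let e , inj , onto , into = enumerate S in
  suc ∘ e , inj ∘ suc-injective , (λ { (Vec.there v∈) → let j , eq = onto v∈ in j , cong suc eq }) , Vec.there ∘ into

module Selection {n : ℕ} (G : Graph n) (ter : Fin 3 → Fin n) (ter-injective : ∀ {i j} → ter i ≡ ter j → i ≡ j)
  (lab : Fin n → Fin n) (blocks : ConnectedBlocks (Terminals.InnerEdge G ter ter-injective) lab) where

  open Terminals G ter ter-injective
  open Packing G ter ter-injective lab blocks

  HasKind : Kind → Fin n → Set
  HasKind nothing  i = ∀ s → Meets i s
  HasKind (just j) i = ¬ Meets i j × ∀ s → s ≢ j → Meets i s

  hasKind? : ∀ c i → Dec (HasKind c i)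
  hasKind? nothing  i = all? (meets? i)
  hasKind? (just j) i = ¬? (meets? i j) ×-dec all? λ s → ¬? (s ≟ j) →-dec meets? i s

  hasKind-unique : ∀ {c d i} → HasKind c i → HasKind d i → c ≡ d
  hasKind-unique {nothing} {nothing} _ _ = refl
  hasKind-unique {nothing} {just j} m (¬m , _) = contradiction (m j) ¬m
  hasKind-unique {just j} {nothing} (¬m , _) m = contradiction (m j) ¬m
  hasKind-unique {just j} {just j′} (¬m , _) (_ , m) with j ≟ j′
  ... | yes refl = refl
  ... | no  j≢j′ = contradiction (m j j≢j′) ¬m

  count : (Fin n → Bool) → Kind → ℕ
  count P c = # (λ i → P i ∧ does (hasKind? c i))

  remove : (Fin n → Bool) → Fin n → Fin n → Bool
  remove P x i = P i ∧ not (does (i ≟ x))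

  -- A block has only one kind, so taking it lowers a single count, and by at most one.
  count-remove : ∀ P {d x} → HasKind d x → ∀ c → count P c ≤ ind (does (c ≟ᴷ d)) + count (remove P x) c
  count-remove P {d} {x} kx c = begin
    count P c                                       ≤⟨ ∑-mono-≤ pointwise ⟩
    ∑ (λ i → (if does (i ≟ x) then ind (does (c ≟ᴷ d)) else 0) + ind (remove P x i ∧ does (hasKind? c i)))
                                                    ≡⟨ ∑-distrib-+ (λ i → if does (i ≟ x) then ind (does (c ≟ᴷ d)) else 0) _ ⟩
    ∑ (λ i → if does (i ≟ x) then ind (does (c ≟ᴷ d)) else 0) + count (remove P x) c
                                                    ≤⟨ +-monoˡ-≤ _ (∑-at-≤ x _) ⟩
    ind (does (c ≟ᴷ d)) + count (remove P x) c      ∎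
    where
    open ≤-Reasoning
    pointwise : ∀ i → ind (P i ∧ does (hasKind? c i)) ≤
      (if does (i ≟ x) then ind (does (c ≟ᴷ d)) else 0) + ind (remove P x i ∧ does (hasKind? c i))
    pointwise i with i ≟ x
    ... | no  _ rewrite ∧-identityʳ (P i) = ≤-refl
    ... | yes refl = ≤-trans (ind-mono-≤ _ (does (c ≟ᴷ d))
      (λ e → dec-true (c ≟ᴷ d) (hasKind-unique (does-true (hasKind? c x) (proj₂ (∧-true e))) kx))) (m≤m+n _ _)

  Supply : (Fin n → Bool) → Kind → (Kind → ℕ) → Set
  Supply P d m = ∃ λ x → P x ≡ true × HasKind d x × (∀ c → m c ≤ count (remove P x) c)

  extract : ∀ P d (m : Kind → ℕ) → (∀ c → ind (does (c ≟ᴷ d)) + m c ≤ count P c) → Supply P d m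
  extract P d m m≤ = found (#-witness (λ i → P i ∧ does (hasKind? d i)) nonempty)
    where
    nonempty : 1 ≤ count P d
    nonempty = ≤-trans (≤-trans (≤-reflexive (sym (cong ind (dec-true (d ≟ᴷ d) refl)))) (m≤m+n _ (m d))) (m≤ d)
    found : (∃ λ x → P x ∧ does (hasKind? d x) ≡ true) → Supply P d m
    found (x , e) = x , proj₁ (∧-true e) , kx ,
      λ c → +-cancelˡ-≤ (ind (does (c ≟ᴷ d))) _ _ (≤-trans (m≤ c) (count-remove P kx c))
      where kx = does-true (hasKind? d x) (proj₂ (∧-true e))

  -- The last clause confines the bundles to the blocks available in `P`; it makes them disjoint
  -- from any bundle removed beforehand.
  Selected : (Fin n → Bool) → ℕ → Set
  Selected P ℓ = ∃ λ (b : Fin ℓ → Bundle) → (∀ i → Good (b i)) ×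
    (∀ i j → i ≢ j → Disjoint (b i) (b j)) × (∀ i l → Member l (b i) → P l ≡ true)

  removed-self : ∀ P x → remove P x x ≡ false
  removed-self P x rewrite dec-true (x ≟ x) refl = ∧-zeroʳ (P x)

  prepend : ∀ {P P′ ℓ x y} → Good (x , y) → P x ≡ true → P y ≡ true →
    P′ x ≡ false → P′ y ≡ false → (∀ i → P′ i ≡ true → P i ≡ true) → Selected P′ ℓ → Selected P (suc ℓ)
  prepend {P} {P′} {ℓ} {x} {y} good Px Py P′x P′y P′⊆P (b , b-good , b-disjoint , b⊆P′) =
    b⁺ , (λ { zero → good ; (suc i) → b-good i }) , disjoint ,
    λ { zero l (inj₁ refl) → Px ; zero l (inj₂ refl) → Py ; (suc i) l mem → P′⊆P l (b⊆P′ i l mem) }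
    where
    b⁺ : Fin (suc ℓ) → Bundle
    b⁺ zero    = x , y
    b⁺ (suc i) = b i
    fresh : ∀ i l → Member l (x , y) → ¬ Member l (b i)
    fresh i l (inj₁ refl) mem with () ← trans (sym P′x) (b⊆P′ i l mem)
    fresh i l (inj₂ refl) mem with () ← trans (sym P′y) (b⊆P′ i l mem)
    disjoint : ∀ i j → i ≢ j → Disjoint (b⁺ i) (b⁺ j)
    disjoint zero    zero    0≢0 = contradiction refl 0≢0
    disjoint zero    (suc j) _   = fresh j
    disjoint (suc i) zero    _   l mem mem₀ = fresh i l mem₀ mem
    disjoint (suc i) (suc j) i≢j = b-disjoint i j (i≢j ∘ cong suc)

  mutual
    -- Greedy choice works because blocks of one kind are interchangeable: the supply left always
    -- covers the demand left.
    select : ∀ ds P → (∀ c → demand c ds ≤ count P c) → Selected P (length ds)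
    select []             P _      = (λ ()) , (λ ()) , (λ ()) , λ ()
    select (nothing ∷ ds) P enough = take-full ds P (extract P nothing (λ c → demand c ds) enough)
    select (just l ∷ ds)  P enough = take-first ds P t≢l r≢l t≢r
      (extract P (just t) (λ c → ind (does (c ≟ᴷ just r)) + demand c ds)
        λ c → ≤-trans (≤-reflexive (sym (+-assoc (ind (does (c ≟ᴷ just t))) _ _))) (enough c))
      where
      t = proj₁ (others l)
      r = proj₁ (proj₂ (others l))
      t≢l = proj₁ (proj₂ (proj₂ (others l)))
      r≢l = proj₁ (proj₂ (proj₂ (proj₂ (others l))))
      t≢r = proj₁ (proj₂ (proj₂ (proj₂ (proj₂ (others l)))))

    take-full : ∀ ds P → Supply P nothing (λ c → demand c ds) → Selected P (suc (length ds))
    take-full ds P (x , Px , kx , enough) =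
      prepend (0F , kx 0F , kx 0F , inj₁ ∘ kx) Px Px (removed-self P x) (removed-self P x)
        (λ i → proj₁ ∘ ∧-true) (select ds (remove P x) enough)

    take-first : ∀ ds P {l t r} → t ≢ l → r ≢ l → t ≢ r →
      Supply P (just t) (λ c → ind (does (c ≟ᴷ just r)) + demand c ds) → Selected P (suc (length ds))
    take-first ds P t≢l r≢l t≢r (x , Px , kx , enough) =
      take-second ds P t≢l r≢l t≢r x Px kx (extract (remove P x) (just _) (λ c → demand c ds) enough)

    take-second : ∀ ds P {l t r} → t ≢ l → r ≢ l → t ≢ r → ∀ x → P x ≡ true → HasKind (just t) x →
      Supply (remove P x) (just r) (λ c → demand c ds) → Selected P (suc (length ds))
    take-second ds P {l} {t} {r} t≢l r≢l t≢r x Px (_ , mx) (y , P′y , (_ , my) , enough) =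
      prepend (l , mx l (t≢l ∘ sym) , my l (r≢l ∘ sym) , meets-all)
        Px (proj₁ (∧-true P′y)) (cong (_∧ not (does (x ≟ y))) (removed-self P x)) (removed-self (remove P x) y)
        (λ i → proj₁ ∘ ∧-true ∘ proj₁ ∘ ∧-true) (select ds (remove (remove P x) y) enough)
      where
      meets-all : ∀ s → Meets x s ⊎ Meets y s
      meets-all s with s ≟ t
      ... | yes refl = inj₂ (my s t≢r)
      ... | no  s≢t  = inj₁ (mx s s≢t)

  everything : Fin n → Bool
  everything _ = true

  supply : Kind → ℕ
  supply = count everything

  open Reduction {n} {Fin 3} _≟_ Touches using (Robust; cut)

  -- With no edges left, blocks can be coloured independently. The cheapest cut around `s` puts into
  -- `sep` precisely the blocks that meet `s` and some other terminal, and these have the three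
  -- kinds counted here.
  robust-count : ∀ {k} → Robust k lab [] → ∀ {s t r} → (∀ j → j ≡ s ⊎ j ≡ t ⊎ j ≡ r) →
    k ≤ supply nothing + (supply (just t) + supply (just r))
  robust-count {k} robust {s} {t} {r} cover = begin
    k                                       ≤⟨ robust s side (cut [] at-s at-others) ⟩
    weight side                             ≤⟨ ∑-mono-≤ pointwise ⟩
    ∑ (λ i → K nothing i + (K (just t) i + K (just r) i)) ≡⟨ ∑-distrib-+ (K nothing) (λ i → K (just t) i + K (just r) i) ⟩
    ∑ (K nothing) + ∑ (λ i → K (just t) i + K (just r) i) ≡⟨ cong (∑ (K nothing) +_) (∑-distrib-+ (K (just t)) (K (just r))) ⟩
    ∑ (K nothing) + (∑ (K (just t)) + ∑ (K (just r)))     ∎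
    where
    open ≤-Reasoning
    K : Kind → Fin n → ℕ
    K c i = ind (does (hasKind? c i))
    has : ∀ c i → HasKind c i → 1 ≤ K c i
    has c i h = ≤-reflexive (sym (cong ind (dec-true (hasKind? c i) h)))
    colour : ∀ {A B C : Set} → Dec A → Dec B → Dec C → Side
    colour (no  _) _       _       = far
    colour (yes _) (no  _) (no  _) = near
    colour (yes _) (no  _) (yes _) = sep
    colour (yes _) (yes _) _       = sep
    side : Fin n → Side
    side i = colour (meets? i s) (meets? i t) (meets? i r)
    everywhere : ∀ {P : Fin 3 → Set} → P s → P t → P r → ∀ j → P j
    everywhere Ps Pt Pr j with cover j
    ... | inj₁ refl        = Ps
    ... | inj₂ (inj₁ refl) = Pt
    ... | inj₂ (inj₂ refl) = Pr
    pointwise : ∀ i → size (side i) ≤ K nothing i + (K (just t) i + K (just r) i)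
    pointwise i = bound (meets? i s) (meets? i t) (meets? i r)
      where
      bound : (ds : Dec (Meets i s)) (dt : Dec (Meets i t)) (dr : Dec (Meets i r)) →
        size (colour ds dt dr) ≤ K nothing i + (K (just t) i + K (just r) i)
      bound (no  _) _       _        = z≤n
      bound (yes _) (no  _) (no  _)  = z≤n
      bound (yes m) (no ¬m) (yes m′) =
        ≤-trans (has (just t) i (¬m , everywhere (λ _ → m) (contradiction refl) (λ _ → m′)))
          (≤-trans (m≤m+n _ _) (m≤n+m _ (K nothing i)))
      bound (yes m) (yes m′) (no ¬m) =
        ≤-trans (has (just r) i (¬m , everywhere (λ _ → m) (λ _ → m′) (contradiction refl)))
          (≤-trans (m≤n+m _ (K (just t) i)) (m≤n+m _ (K nothing i)))
      bound (yes m) (yes m′) (yes m″) = ≤-trans (has nothing i (everywhere m m′ m″)) (m≤m+n _ _)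
    at-s : ∀ e → Touches e s → side (lab e) ≢ far
    at-s e e~s = not-far (meets? (lab e) s) (meets? (lab e) t) (meets? (lab e) r)
      where
      not-far : ∀ {B C : Set} (ds : Dec (Meets (lab e) s)) (dt : Dec B) (dr : Dec C) → colour ds dt dr ≢ far
      not-far (no ¬m) _       _       _ = ¬m (e , refl , e~s)
      not-far (yes _) (no  _) (no  _) ()
      not-far (yes _) (no  _) (yes _) ()
      not-far (yes _) (yes _) _       ()
    at-others : ∀ e j → j ≢ s → Touches e j → side (lab e) ≢ near
    at-others e j j≢s e~j = not-near (meets? (lab e) s) (meets? (lab e) t) (meets? (lab e) r)
      where
      not-near : ∀ {A : Set} (ds : Dec A) (dt : Dec (Meets (lab e) t)) (dr : Dec (Meets (lab e) r)) → colour ds dt dr ≢ near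
      not-near (yes _) (no ¬t) (no ¬r) _ =
        everywhere {λ j → j ≢ s → ¬ Meets (lab e) j} (contradiction refl) (λ _ → ¬t) (λ _ → ¬r) j j≢s (e , refl , e~j)
      not-near (no  _) _       _       ()
      not-near (yes _) (no  _) (yes _) ()
      not-near (yes _) (yes _) _       ()

  many-bundles : ∀ {k} → k ≤ 5 → Robust k lab [] → ∃ λ ℓ → k ∸ 1 ≤ ℓ × Selected everything ℓ
  many-bundles {k} k≤5 robust = selected (meet-demand supply k≤5 pairs)
    where
    pairs : ∀ t r → t ≢ r → k ≤ supply nothing + (supply (just t) + supply (just r))
    pairs t r t≢r = robust-count robust (proj₂ (third-terminal t≢r))
    selected : (∃ λ ds → k ∸ 1 ≤ length ds × (∀ c → demand c ds ≤ supply c)) →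
      ∃ λ ℓ → k ∸ 1 ≤ ℓ × Selected everything ℓ
    selected (ds , long , fit) = length ds , long , select ds _ fit

-- Assembling the packing of the lower bound

module _ {n : ℕ} (G : Graph n) where

  manyTrees : ∀ {k} → k ≤ 5 → (∀ Q → DisconnectsOrTrivial G Q → k ≤ ∣ Q ∣) →
    ∀ {S} → ∣ S ∣ ≡ 3 → ¬ ¬ (∃ λ ℓ → k ∸ 1 ≤ ℓ × TreePacking G S ℓ)
  manyTrees {k} k≤5 κ {S} ∣S∣≡3 ¬∃ with enumerate S
  ... | e rewrite ∣S∣≡3 with e
  ... | ter , inj , onto , into =
    Reduction.reduce _≟_ Touches k innerEdge-sym innerEdges id
      (all-filter innerEdge? (cartesianProduct (allFin n) (allFin n))) (robust-initially κ) (λ x y → λ { refl → ε })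
      λ (lab , robust , blocks) → let ℓ , k≤ℓ , b , good , disjoint , _ = Selection.many-bundles G ter inj lab blocks k≤5 robust in
      Packing.packing G ter inj lab blocks onto into b good disjoint λ p → ¬∃ (ℓ , k≤ℓ , p)
    where open Terminals G ter inj

-- Euler's formula

all-true⁺ : ∀ {A : Set} (p : A → Bool) xs → (∀ x → p x ≡ true) → all p xs ≡ true
all-true⁺ p []       _  = refl
all-true⁺ p (x ∷ xs) px = cong₂ _∧_ (px x) (all-true⁺ p xs px)

all-true⁻ : ∀ {A : Set} (p : A → Bool) {x xs} → all p xs ≡ true → x ∈ˡ xs → p x ≡ true
all-true⁻ p {x} {y ∷ xs} eq x∈ with p y in py
all-true⁻ p eq (here refl) | true = py
all-true⁻ p eq (there x∈)  | true = all-true⁻ p eq x∈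

any-true⁺ : ∀ {A : Set} (p : A → Bool) {x xs} → x ∈ˡ xs → p x ≡ true → any p xs ≡ true
any-true⁺ p (here refl) px rewrite px = refl
any-true⁺ p {xs = y ∷ _} (there x∈) px = trans (cong (p y ∨_) (any-true⁺ p x∈ px)) (∨-zeroʳ (p y))

length-filterᵇ-cartesianProduct : ∀ {A B : Set} (P : A × B → Bool) xs ys →
  length (filterᵇ P (cartesianProduct xs ys)) ≡ listSum (map (λ x → listSum (map (λ y → ind (P (x , y))) ys)) xs)
length-filterᵇ-cartesianProduct P xs ys = trans (length-filterᵇ P (cartesianProduct xs ys)) (split xs)
  where
  split : ∀ xs → listSum (map (ind ∘ P) (cartesianProduct xs ys)) ≡ listSum (map (λ x → listSum (map (λ y → ind (P (x , y))) ys)) xs)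
  split []       = refl
  split (x ∷ xs) = trans (cong listSum (map-++ (ind ∘ P) (map (x ,_) ys) (cartesianProduct xs ys)))
    (trans (sum-++ (map (ind ∘ P) (map (x ,_) ys)) (map (ind ∘ P) (cartesianProduct xs ys)))
      (cong₂ _+_ (cong listSum (sym (map-∘ ys))) (split xs)))

iter-+ : ∀ {A : Set} (f : A → A) i j x → iter f (i + j) x ≡ iter f i (iter f j x)
iter-+ f zero    j x = refl
iter-+ f (suc i) j x = cong f (iter-+ f i j x)

iter-fix : ∀ {A : Set} (f : A → A) k {x} → f x ≡ x → iter f k x ≡ x
iter-fix f zero    fx = refl
iter-fix f (suc k) fx = trans (cong f (iter-fix f k fx)) fx

module _ {n : ℕ} (G : Graph n) where

  degree : Fin n → ℕ
  degree u = # (adj G u)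

  -- The neighbourhood of `u` separates `u` from any non-neighbour, or leaves only `u` if there is
  -- none.
  connectivity≤degree : ∀ {k} → (∀ Q → DisconnectsOrTrivial G Q → k ≤ ∣ Q ∣) → ∀ u → k ≤ degree u
  connectivity≤degree {k} κ u = ≤-trans (separate (any? λ v → ¬? (v ≟ u) ×-dec ¬? (adj? v)))
      (≤-trans (≤-reflexive (∣⟨⟩∣ adj?)) (#-mono-≤ (does ∘ adj?) (adj G u) (λ v → does-true (adj? v))))
    where
    adj? : ∀ v → Dec (adj G u v ≡ true)
    adj? v = adj G u v Bool.≟ true
    u∉ : ¬ adj G u u ≡ true
    u∉ e = case trans (sym e) (irrefl G u) of λ ()
    next : ∀ {w x} → w ≡ u → x ∈ ∁ ⟨ adj? ⟩ → adj G w x ≡ true → x ≡ u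
    next refl x∈ e = contradiction (∈⟨⟩⁺ adj? e) (x∈∁p⇒x∉p x∈)
    separate : Dec (∃ λ v → v ≢ u × ¬ adj G u v ≡ true) → k ≤ ∣ ⟨ adj? ⟩ ∣
    separate (yes (v , v≢u , v∉)) = κ ⟨ adj? ⟩ (inj₂ (u , v ,
      x∉p⇒x∈∁p (u∉ ∘ ∈⟨⟩⁻ adj?) , x∉p⇒x∈∁p (v∉ ∘ ∈⟨⟩⁻ adj?) ,
      λ walk → v≢u (walk-invariant (_≡ u) next walk refl)))
    separate (no none) = κ ⟨ adj? ⟩ (inj₁ (≤-trans (p⊆q⇒∣p∣≤∣q∣ only-u) (≤-reflexive (∣⁅x⁆∣≡1 u))))
      where
      only-u : ∁ ⟨ adj? ⟩ ⊆ ⁅ u ⁆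
      only-u {v} v∈ with v ≟ u
      ... | yes refl = x∈⁅x⁆ u
      ... | no  v≢u  = contradiction (v , v≢u , x∈∁p⇒x∉p v∈ ∘ ∈⟨⟩⁺ adj?) none

  degreeSum : ℕ
  degreeSum = ∑ degree

  countB≡# : ∀ (P : Fin n → Bool) → countB P ≡ # P
  countB≡# P = listSum-allFin (ind ∘ P)

  degreeSum≤2edges : degreeSum ≤ edgeCount G + edgeCount G
  degreeSum≤2edges = begin
    ∑ (λ u → ∑ λ v → ind (adj G u v))                           ≤⟨ ∑-mono-≤ (λ u → ∑-mono-≤ (pointwise u)) ⟩
    ∑ (λ u → ∑ λ v → up u v + up v u)                           ≡⟨ sum-cong-≗ (λ u → ∑-distrib-+ (up u) (λ v → up v u)) ⟩
    ∑ (λ u → ∑ (up u) + ∑ (λ v → up v u))                       ≡⟨ ∑-distrib-+ (λ u → ∑ (up u)) _ ⟩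
    ∑ (λ u → ∑ (up u)) + ∑ (λ u → ∑ (λ v → up v u))             ≡⟨ cong (∑ (λ u → ∑ (up u)) +_) (∑-comm (λ u v → up v u)) ⟩
    ∑ (λ u → ∑ (up u)) + ∑ (λ u → ∑ (up u))                     ≡⟨ cong₂ _+_ edges≡ edges≡ ⟨
    edgeCount G + edgeCount G                                   ∎
    where
    open ≤-Reasoning
    up : Fin n → Fin n → ℕ
    up u v = ind (adj G u v ∧ (suc (toℕ u) ≤ᵇ toℕ v))
    edges≡ : edgeCount G ≡ ∑ (λ u → ∑ (up u))
    edges≡ = trans (listSum-allFin (λ u → countB (λ v → adj G u v ∧ (suc (toℕ u) ≤ᵇ toℕ v))))
      (sum-cong-≗ λ u → countB≡# (λ v → adj G u v ∧ (suc (toℕ u) ≤ᵇ toℕ v)))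
    up-< : ∀ {u v} → adj G u v ≡ true → toℕ u < toℕ v → 1 ≤ up u v
    up-< {u} {v} e u<v rewrite e | Equivalence.to T-≡ (≤⇒≤ᵇ u<v) = s≤s z≤n
    pointwise : ∀ u v → ind (adj G u v) ≤ up u v + up v u
    pointwise u v with adj G u v in e
    ... | false = z≤n
    ... | true with <-cmp (toℕ u) (toℕ v)
    ...   | tri< u<v _ _ = ≤-trans (subst (λ b → 1 ≤ ind (b ∧ (suc (toℕ u) ≤ᵇ toℕ v))) e (up-< e u<v)) (m≤m+n _ _)
    ...   | tri> _ _ v<u = ≤-trans (up-< (trans (adj-sym G v u) e) v<u) (m≤n+m _ _)
    ...   | tri≈ _ u≡v _ with refl ← toℕ-injective u≡v with () ← trans (sym e) (irrefl G u)

  module _ (R : Rotation G) (2≤degree : ∀ u → 2 ≤ degree u) where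

    private
      F = φ G R

    Dart : Fin n × Fin n → Set
    Dart (u , v) = adj G u v ≡ true

    φ-dart : ∀ d → Dart d → Dart (F d)
    φ-dart (u , v) e = closed R v u (trans (adj-sym G v u) e)

    iter-dart : ∀ k d → Dart d → Dart (iter F k d)
    iter-dart zero    d e = e
    iter-dart (suc k) d e = φ-dart (iter F k d) (iter-dart k d e)

    φ-injective : ∀ {d d′} → Dart d → Dart d′ → F d ≡ F d′ → d ≡ d′
    φ-injective {u , v} {u′ , v′} e e′ eq with refl ← cong proj₁ eq =
      cong (_, v) (inj R v u u′ (trans (adj-sym G v u) e) (trans (adj-sym G v u′) e′) (cong proj₂ eq))

    iter-injective : ∀ k {d d′} → Dart d → Dart d′ → iter F k d ≡ iter F k d′ → d ≡ d′
    iter-injective zero    e e′ eq = eq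
    iter-injective (suc k) e e′ eq = iter-injective k e e′ (φ-injective (iter-dart k _ e) (iter-dart k _ e′) eq)

    no-face₁ : ∀ d → Dart d → F d ≢ d
    no-face₁ (u , v) e eq with refl ← cong proj₁ eq with () ← trans (sym e) (irrefl G u)

    -- A face of length two makes the rotation at `v` fix `u`; being cyclic, that rotation then
    -- reaches no other neighbour, against degree at least 2.
    no-face₂ : ∀ d → Dart d → F (F d) ≢ d
    no-face₂ (u , v) e eq = <⇒≱ (2≤degree v) (≤-trans (#-mono-≤ (adj G v) (λ w → does (w ≟ u)) only-u) (∑-at-≤ u 1))
      where
      only-u : ∀ w → adj G v w ≡ true → does (w ≟ u) ≡ true
      only-u w e′ = let m , reached = cyclic R v u w (trans (adj-sym G v u) e) e′ in
        dec-true (w ≟ u) (trans (sym reached) (iter-fix (ρ R v) m (cong proj₁ eq)))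

    -- A return time, by pigeonhole on the `n * n` pairs of vertices; it may exceed the least
    -- period. The upper bound keeps it within the range of exponents that `orbitMin` inspects.
    period : ∀ d → Dart d → ∃ λ L → 3 ≤ L × L ≤ n * n × iter F L d ≡ d
    period d e = period′ (pigeonhole (n<1+n (n * n)) (λ i → code (toℕ i)))
      where
      code : ℕ → Fin (n * n)
      code m = let u , v = iter F m d in combine u v
      code-injective : ∀ i j → code i ≡ code j → iter F i d ≡ iter F j d
      code-injective i j eq = let p , q = combine-injective _ _ _ _ eq in cong₂ _,_ p q
      long : ∀ L → 1 ≤ L → iter F L d ≡ d → 3 ≤ L
      long 1 _ eq = contradiction eq (no-face₁ d e)
      long 2 _ eq = contradiction eq (no-face₂ d e)
      long (suc (suc (suc L))) _ _ = s≤s (s≤s (s≤s z≤n))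
      period′ : ∃₂ (λ (i j : Fin (suc (n * n))) → toℕ i < toℕ j × code (toℕ i) ≡ code (toℕ j)) →
        ∃ λ L → 3 ≤ L × L ≤ n * n × iter F L d ≡ d
      period′ (i , j , i<j , eq) =
        L , long L (m<n⇒0<n∸m i<j) returns , ≤-trans (m∸n≤m (toℕ j) (toℕ i)) (≤-pred (toℕ<n j)) , returns
        where
        L = toℕ j ∸ toℕ i
        returns : iter F L d ≡ d
        returns = sym (iter-injective (toℕ i) e (iter-dart L d e) (trans (code-injective (toℕ i) (toℕ j) eq)
          (trans (cong (λ m → iter F m d) (sym (m+[n∸m]≡n (<⇒≤ i<j)))) (iter-+ F (toℕ i) L d))))

    key-injective : ∀ d d′ → key G R d ≡ key G R d′ → d ≡ d′
    key-injective (u , v) (u′ , v′) eq =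
      let p , q = combine-injective u v u′ v′ (toℕ-injective (trans (code u v) (trans eq (sym (code u′ v′))))) in cong₂ _,_ p q
      where
      code : ∀ (u v : Fin n) → toℕ (combine u v) ≡ toℕ u * n + toℕ v
      code u v = trans (toℕ-combine u v) (cong (_+ toℕ v) (*-comm n (toℕ u)))

    FaceDart : Fin n × Fin n → Set
    FaceDart d = Dart d × orbitMin G R d ≡ true

    face-least : ∀ d → FaceDart d → ∀ {k} → k < n * n → key G R d ≤ key G R (iter F k d)
    face-least d (_ , least) {k} k<n² = ≤ᵇ⇒≤ _ _ (Equivalence.from T-≡
      (all-true⁻ (λ k → key G R d ≤ᵇ key G R (iter F k d)) least (∈-upTo⁺ k<n²)))

    -- Each dart is least in the orbit they share, so their keys agree. The positive `j` is treated
    -- apart because the way back takes `L ∸ j` steps, which must be strictly fewer than `n * n`.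
    same-face : ∀ {d d′} → FaceDart d → FaceDart d′ → ∀ j → j < 3 → d ≡ iter F j d′ → d ≡ d′
    same-face Fd Fd′ zero _ eq = eq
    same-face {d} {d′} Fd Fd′ j@(suc _) j<3 d≡ = conclude (period d′ (proj₁ Fd′))
      where
      conclude : (∃ λ L → 3 ≤ L × L ≤ n * n × iter F L d′ ≡ d′) → d ≡ d′
      conclude (L , 3≤L , L≤n² , returns) = key-injective d d′ (≤-antisym
        (subst (λ x → key G R d ≤ key G R x) back (face-least d Fd (<-≤-trans (∸-monoʳ-< (s≤s z≤n) j≤L) L≤n²)))
        (subst (λ x → key G R d′ ≤ key G R x) (sym d≡) (face-least d′ Fd′ (<-≤-trans (<-≤-trans j<3 3≤L) L≤n²))))
        where
        j≤L : j ≤ L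
        j≤L = <⇒≤ (<-≤-trans j<3 3≤L)
        back : iter F (L ∸ j) d ≡ d′
        back = trans (cong (iter F (L ∸ j)) d≡) (trans (sym (iter-+ F (L ∸ j) j d′))
          (trans (cong (λ m → iter F m d′) (m∸n+n≡m j≤L)) returns))

    face-darts-injective : ∀ {d d′} → FaceDart d → FaceDart d′ → ∀ {a b} → a ≤ b → b < 3 →
      iter F a d ≡ iter F b d′ → d ≡ d′ × a ≡ b
    face-darts-injective {d} {d′} Fd Fd′ {a} {b} a≤b b<3 eq = d≡d′ ,
      ≤-antisym a≤b (m∸n≡0⇒m≤n (no-shift (b ∸ a) (≤-<-trans (m∸n≤m b a) b<3) (trans (sym shift) d≡d′)))
      where
      shift : d ≡ iter F (b ∸ a) d′
      shift = iter-injective a (proj₁ Fd) (iter-dart (b ∸ a) d′ (proj₁ Fd′))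
        (trans eq (trans (cong (λ m → iter F m d′) (sym (m+[n∸m]≡n a≤b))) (iter-+ F a (b ∸ a) d′)))
      d≡d′ : d ≡ d′
      d≡d′ = same-face Fd Fd′ (b ∸ a) (≤-<-trans (m∸n≤m b a) b<3) shift
      no-shift : ∀ j → j < 3 → iter F j d′ ≡ d′ → j ≡ 0
      no-shift 0 _ _ = refl
      no-shift 1 _ eq = contradiction eq (no-face₁ d′ (proj₁ Fd′))
      no-shift 2 _ eq = contradiction eq (no-face₂ d′ (proj₁ Fd′))
      no-shift (suc (suc (suc _))) (s≤s (s≤s (s≤s ()))) _

    -- The least dart of each face and its next two iterates are pairwise different, also across
    -- faces.
    3faces≤degreeSum : faces G R * 3 ≤ degreeSum
    3faces≤degreeSum = subst (faces G R * 3 ≤_) darts-length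
      (subst (λ m → m * 3 ≤ length darts) (length-filterᵇ-cartesianProduct isFace (allFin n) (allFin n))
        (injective⇒≤ {f = g} g-injective))
      where
      pairs = cartesianProduct (allFin n) (allFin n)
      isDart isFace : Fin n × Fin n → Bool
      isDart (u , v) = adj G u v
      isFace (u , v) = adj G u v ∧ orbitMin G R (u , v)
      darts faceDarts : List (Fin n × Fin n)
      darts     = filterᵇ isDart pairs
      faceDarts = filterᵇ isFace pairs
      darts-length : length darts ≡ degreeSum
      darts-length = trans (length-filterᵇ-cartesianProduct isDart (allFin n) (allFin n))
        (trans (listSum-allFin (λ u → countB (adj G u))) (sum-cong-≗ λ u → countB≡# (adj G u)))
      faceDarts-unique : Unique faceDarts
      faceDarts-unique = filter⁺ (T? ∘ isFace) (cartesianProduct⁺ (allFin⁺ n) (allFin⁺ n))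
      faceDart : ∀ i → FaceDart (lookup faceDarts i)
      faceDart i = ∧-true (Equivalence.to T-≡ (proj₂ (∈-filter⁻ (T? ∘ isFace) {xs = pairs} (∈-lookup i))))
      listed : ∀ d → Dart d → d ∈ˡ darts
      listed (u , v) e = ∈-filterᵇ⁺ isDart (∈-cartesianProduct⁺ (∈-allFin u) (∈-allFin v)) e
      point : Fin (length faceDarts) → Fin 3 → Fin n × Fin n
      point i a = iter F (toℕ a) (lookup faceDarts i)
      point-listed : ∀ i a → point i a ∈ˡ darts
      point-listed i a = listed (point i a) (iter-dart (toℕ a) _ (proj₁ (faceDart i)))
      point-injective : ∀ {i a j b} → point i a ≡ point j b → i ≡ j × a ≡ b
      point-injective {i} {a} {j} {b} eq with ≤-total (toℕ a) (toℕ b)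
      ... | inj₁ a≤b = let p , q = face-darts-injective (faceDart i) (faceDart j) a≤b (toℕ<n b) eq in
        Unique-lookup-injective faceDarts-unique i j p , toℕ-injective q
      ... | inj₂ b≤a = let p , q = face-darts-injective (faceDart j) (faceDart i) b≤a (toℕ<n a) (sym eq) in
        Unique-lookup-injective faceDarts-unique i j (sym p) , toℕ-injective (sym q)
      g : Fin (length faceDarts * 3) → Fin (length darts)
      g x = let i , a = remQuot 3 x in index (point-listed i a)
      g-injective : ∀ {x y} → g x ≡ g y → x ≡ y
      g-injective {x} {y} eq =
        let i , a = remQuot 3 x
            j , b = remQuot 3 y
            p , q = point-injective {i} {a} {j} {b} (trans (lookup-index (point-listed i a))
              (trans (cong (lookup darts) eq) (sym (lookup-index (point-listed j b)))))
        in trans (sym (combine-remQuot {length faceDarts} 3 x)) (trans (cong₂ combine p q) (combine-remQuot {length faceDarts} 3 y))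

  isolated≡0 : (∀ u → 1 ≤ degree u) → isolated G ≡ 0
  isolated≡0 1≤degree = trans (countB≡# _) (trans (sum-cong-≗ zeros) (trans (∑-const n 0) (*-zeroʳ n)))
    where
    zeros : ∀ v → ind (not (any (adj G v) (allFin n))) ≡ 0
    zeros v = let w , e = #-witness (adj G v) (1≤degree v) in cong (ind ∘ not) (any-true⁺ (adj G v) (∈-allFin w) e)

-- Vertex `zero` is least in its component whatever `reach` computes.
1≤components : ∀ {n} (G : Graph (suc n)) → 1 ≤ components G
1≤components {n} G = ≤-trans (≤-trans (≤-reflexive (sym (cong ind least))) (m≤m+n _ _)) (≤-reflexive (sym (countB≡# G isLeast)))
  where
  isLeast : Fin (suc n) → Bool
  isLeast v = all (λ w → not (reach G (suc n) w v) ∨ (toℕ v ≤ᵇ toℕ w)) (allFin (suc n))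
  least : isLeast zero ≡ true
  least = all-true⁺ (λ w → not (reach G (suc n) w zero) ∨ (0 ≤ᵇ toℕ w)) (allFin (suc n)) λ w → ∨-zeroʳ (not (reach G (suc n) w zero))

-- If all degrees are at least 6, then `6 V ≤ D` and `3 F ≤ D` with `D ≤ 2 E`, so
-- `6 (V + F) ≤ 3 D ≤ 6 E`. Euler's formula without isolated vertices says `V + F = E + 2 C`, which
-- exceeds `E`.
planar⇒connectivity≤5 : ∀ {n} (G : Graph (suc n)) → Planar G → ∀ {k} → (∀ Q → DisconnectsOrTrivial G Q → k ≤ ∣ Q ∣) → k ≤ 5
planar⇒connectivity≤5 {n} G (R , euler) {k} κ = decidable-stable (k ≤? 5) λ k≰5 →
  let 6≤degree = λ u → ≤-trans (≰⇒> k≰5) (connectivity≤degree G κ u) in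
  count-contradiction
    (3faces≤degreeSum G R λ u → ≤-trans (s≤s (s≤s z≤n)) (6≤degree u))
    (≤-trans (≤-reflexive (sym (∑-const (suc n) 6))) (∑-mono-≤ 6≤degree))
    (isolated≡0 G λ u → ≤-trans (s≤s z≤n) (6≤degree u))
  where
  open ≤-Reasoning
  open +-*-Solver
  V = suc n
  F = faces G R
  E = edgeCount G
  C = components G
  D = degreeSum G
  count-contradiction : F * 3 ≤ D → V * 6 ≤ D → isolated G ≡ 0 → ⊥
  count-contradiction 3F≤D 6V≤D I≡0 = <-irrefl refl (begin-strict
    E * 6                     <⟨ *-monoˡ-< 6 (m<m+n E (≤-trans (s≤s z≤n) (*-monoʳ-≤ 2 (1≤components G)))) ⟩
    (E + 2 * C) * 6           ≡⟨ cong (_* 6) euler ⟨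
    (V + F + isolated G) * 6  ≡⟨ cong (λ i → (V + F + i) * 6) I≡0 ⟩
    (V + F + 0) * 6           ≡⟨ solve 2 (λ v f → (v :+ f :+ con 0) :* con 6 := v :* con 6 :+ f :* con 3 :* con 2) refl V F ⟩
    V * 6 + F * 3 * 2         ≤⟨ +-mono-≤ 6V≤D (*-monoˡ-≤ 2 3F≤D) ⟩
    D + D * 2                 ≡⟨ solve 1 (λ d → d :+ d :* con 2 := d :* con 3) refl D ⟩
    D * 3                     ≤⟨ *-monoˡ-≤ 3 (degreeSum≤2edges G) ⟩
    (E + E) * 3               ≡⟨ solve 1 (λ e → (e :+ e) :* con 3 := e :* con 6) refl E ⟩
    E * 6                     ∎)

-- The upper bound

¬¬-maximum : ∀ (P : ℕ → Set) {m N} → P m → (∀ i → P i → i ≤ N) → ¬ ¬ (∃ λ ℓ → P ℓ × (∀ i → P i → i ≤ ℓ))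
¬¬-maximum P {m} {N} Pm bound ¬∃ = climb N m (m≤n+m N m) Pm
  where
  climb : ∀ gap m → N ≤ m + gap → ¬ P m
  climb zero      m N≤ Pm = ¬∃ (m , Pm , λ i Pi → ≤-trans (bound i Pi) (≤-trans N≤ (≤-reflexive (+-identityʳ m))))
  climb (suc gap) m N≤ Pm = ¬∃ (m , Pm , λ i Pi → decidable-stable (i ≤? m) λ i≰m →
    climb gap i (≤-trans N≤ (≤-trans (≤-reflexive (+-suc m gap)) (+-monoˡ-≤ gap (≰⇒> i≰m)))) Pi)

module _ {n : ℕ} (u v : Fin n) where

  pair-count : ∑ (λ x → ind (does (x ≟ u)) + ind (does (x ≟ v))) ≤ 2
  pair-count = ≤-trans (≤-reflexive (∑-distrib-+ (λ x → ind (does (x ≟ u))) (λ x → ind (does (x ≟ v)))))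
    (+-mono-≤ (∑-at-≤ u 1) (∑-at-≤ v 1))

  third-vertex : 3 ≤ n → ∃ λ w → w ≢ u × w ≢ v
  third-vertex 3≤n = decidable-stable (any? λ w → ¬? (w ≟ u) ×-dec ¬? (w ≟ v)) λ none →
    <⇒≱ 3≤n (begin
      n                                                        ≡⟨ *-identityʳ n ⟨
      n * 1                                                    ≡⟨ ∑-const n 1 ⟨
      ∑ {n} (λ _ → 1)                                          ≤⟨ ∑-mono-≤ (covered none) ⟩
      ∑ (λ x → ind (does (x ≟ u)) + ind (does (x ≟ v)))        ≤⟨ pair-count ⟩
      2                                                        ∎)
    where
    open ≤-Reasoning
    covered : ¬ (∃ λ w → w ≢ u × w ≢ v) → ∀ x → 1 ≤ ind (does (x ≟ u)) + ind (does (x ≟ v))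
    covered none x with x ≟ u | x ≟ v
    ... | yes _  | _      = s≤s z≤n
    ... | no  _  | yes _  = s≤s z≤n
    ... | no x≢u | no x≢v = contradiction (x , x≢u , x≢v) none

  module _ (w : Fin n) where

    inTriple? : ∀ x → Dec (x ≡ u ⊎ x ≡ v ⊎ x ≡ w)
    inTriple? x = (x ≟ u) ⊎-dec (x ≟ v) ⊎-dec (x ≟ w)

    triple : Subset n
    triple = ⟨ inTriple? ⟩

    ∣triple∣ : u ≢ v → w ≢ u → w ≢ v → ∣ triple ∣ ≡ 3
    ∣triple∣ u≢v w≢u w≢v = trans (∣⟨⟩∣ inTriple?)
      (≤-antisym upper (injective⇒≤# (does ∘ inTriple?) corner corner-injective corner-in))
      where
      open ≤-Reasoning
      corner : Fin 3 → Fin n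
      corner 0F = u
      corner 1F = v
      corner 2F = w
      corner-injective : Injective _≡_ _≡_ corner
      corner-injective {0F} {0F} _  = refl
      corner-injective {0F} {1F} eq = contradiction eq u≢v
      corner-injective {0F} {2F} eq = contradiction (sym eq) w≢u
      corner-injective {1F} {0F} eq = contradiction (sym eq) u≢v
      corner-injective {1F} {1F} _  = refl
      corner-injective {1F} {2F} eq = contradiction (sym eq) w≢v
      corner-injective {2F} {0F} eq = contradiction eq w≢u
      corner-injective {2F} {1F} eq = contradiction eq w≢v
      corner-injective {2F} {2F} _  = refl
      corner-in : ∀ i → does (inTriple? (corner i)) ≡ true
      corner-in 0F = dec-true (inTriple? u) (inj₁ refl)
      corner-in 1F = dec-true (inTriple? v) (inj₂ (inj₁ refl))
      corner-in 2F = dec-true (inTriple? w) (inj₂ (inj₂ refl))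
      pointwise : ∀ x → ind (does (inTriple? x)) ≤ (ind (does (x ≟ u)) + ind (does (x ≟ v))) + ind (does (x ≟ w))
      pointwise x with x ≟ u | x ≟ v | x ≟ w
      ... | yes _ | _     | _     = s≤s z≤n
      ... | no  _ | yes _ | _     = s≤s z≤n
      ... | no  _ | no  _ | yes _ = s≤s z≤n
      ... | no  _ | no  _ | no  _ = z≤n
      upper : # (does ∘ inTriple?) ≤ 3
      upper = begin
        # (does ∘ inTriple?)   ≤⟨ ∑-mono-≤ pointwise ⟩
        ∑ (λ x → (ind (does (x ≟ u)) + ind (does (x ≟ v))) + ind (does (x ≟ w)))
                               ≡⟨ ∑-distrib-+ (λ x → ind (does (x ≟ u)) + ind (does (x ≟ v))) (λ x → ind (does (x ≟ w))) ⟩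
        ∑ (λ x → ind (does (x ≟ u)) + ind (does (x ≟ v))) + # (λ x → does (x ≟ w))
                               ≤⟨ +-mono-≤ pair-count (∑-at-≤ w 1) ⟩
        3                      ∎

injective⇒≤∣∣ : ∀ {m n} (Q : Subset n) (g : Fin m → Fin n) → Injective _≡_ _≡_ g → (∀ i → g i ∈ Q) → m ≤ ∣ Q ∣
injective⇒≤∣∣ Q g g-inj g∈Q =
  ≤-trans (injective⇒≤# (Vec.lookup Q) g g-inj ([]=⇒lookup ∘ g∈Q)) (≤-reflexive (sym (∣∣≡# Q)))

module _ {n : ℕ} (G : Graph n) where

  loopless : ∀ {u v} → adj G u v ≡ true → u ≢ v
  loopless e refl = case trans (sym e) (irrefl G _) of λ ()

  crosses : ∀ {X : Subset n} {E : Fin n → Fin n → Bool} {u v} (Q : Subset n) → (∀ u v → E u v ≡ true → adj G u v ≡ true) →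
    Walk X E u v → ¬ Walk (∁ Q) (adj G) u v → ∃ λ x → x ∈ X × x ∈ Q
  crosses {u = u} Q E⊆G walk ¬walk with u ∈? Q
  ... | yes u∈Q = u , walk-start walk , u∈Q
  crosses Q E⊆G (here _)       ¬walk | no u∉Q = contradiction (here (x∉p⇒x∈∁p u∉Q)) ¬walk
  crosses Q E⊆G (step _ e walk) ¬walk | no u∉Q = crosses Q E⊆G walk (¬walk ∘ step (x∉p⇒x∈∁p u∉Q) (E⊆G _ _ e))

  module _ {S : Subset n} {ℓ : ℕ} (packed : TreePacking G S ℓ) where
    open TreePacking packed

    module _ {u v : Fin n} (u≢v : u ≢ v) (u∈S : u ∈ S) (v∈S : v ∈ S) where

      neighbour : ∀ i → ∃ λ x → edges (tree i) u x ≡ true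
      neighbour i with connected (tree i) u v (connects i u∈S) (connects i v∈S)
      ... | here _         = contradiction refl u≢v
      ... | step {w = x} _ e _ = x , e

      neighbour-injective : Injective _≡_ _≡_ (proj₁ ∘ neighbour)
      neighbour-injective {i} {j} eq = decidable-stable (i ≟ j) λ i≢j →
        case trans (sym (subst (λ x → edges (tree j) u x ≡ true) (sym eq) (proj₂ (neighbour j))))
          (edge-disjoint i j i≢j u _ (proj₂ (neighbour i))) of λ ()

      neighbour-adj : ∀ i → adj G u (proj₁ (neighbour i)) ≡ true
      neighbour-adj i = edges-in-G (tree i) u _ (proj₂ (neighbour i))

      -- The first vertices after `u` on the trees' walks to `v` are distinct, by edge-disjointness,
      -- and differ from `u`. This settles separators that leave at most one vertex.
      packing<n : ℓ < n
      packing<n = injective⇒≤ {f = f} f-injective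
        where
        f : Fin (suc ℓ) → Fin n
        f zero    = u
        f (suc i) = proj₁ (neighbour i)
        f-injective : Injective _≡_ _≡_ f
        f-injective {zero}  {zero}  _  = refl
        f-injective {zero}  {suc j} eq = contradiction eq (loopless (neighbour-adj j))
        f-injective {suc i} {zero}  eq = contradiction (sym eq) (loopless (neighbour-adj i))
        f-injective {suc i} {suc j} eq = cong suc (neighbour-injective eq)

      packing≤dominating : ∀ Q → ¬ adj G u v ≡ true → (∀ x → x ≢ u → x ≢ v → x ∈ Q) → ℓ ≤ ∣ Q ∣
      packing≤dominating Q u≁v rest∈Q = injective⇒≤∣∣ Q (proj₁ ∘ neighbour) neighbour-injective λ i →
        rest∈Q _ (loopless (neighbour-adj i) ∘ sym) λ x≡v → u≁v (subst (λ x → adj G u x ≡ true) x≡v (neighbour-adj i))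

      packing≤cut : ∀ Q → (∀ {x} → x ∈ S → x ∉ Q) → ¬ Walk (∁ Q) (adj G) u v → ℓ ≤ ∣ Q ∣
      packing≤cut Q S∩Q≡∅ ¬walk = injective⇒≤∣∣ Q (proj₁ ∘ hit) hit-injective (proj₂ ∘ proj₂ ∘ hit)
        where
        hit : ∀ i → ∃ λ x → x ∈ verts (tree i) × x ∈ Q
        hit i = crosses Q (edges-in-G (tree i)) (connected (tree i) u v (connects i u∈S) (connects i v∈S)) ¬walk
        hit-injective : Injective _≡_ _≡_ (proj₁ ∘ hit)
        hit-injective {i} {j} eq = decidable-stable (i ≟ j) λ i≢j →
          S∩Q≡∅ (vert-meet i j i≢j _ (proj₁ (proj₂ (hit i))) (subst (_∈ verts (tree j)) (sym eq) (proj₁ (proj₂ (hit j)))))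
            (proj₂ (proj₂ (hit i)))

  empty-packing : ∀ {S} → TreePacking G S 0
  empty-packing = record { tree = λ () ; connects = λ () ; edge-disjoint = λ () ; vert-meet = λ () }

  -- Minimality of `k₃` applies only to sets `S` whose exact packing number is at hand; the bound
  -- `N` makes a maximum exist under double negation.
  κ₃≤bound : ∀ {k₃ N S} → IsKappa3 G k₃ → ∣ S ∣ ≡ 3 → (∀ ℓ → TreePacking G S ℓ → ℓ ≤ N) → k₃ ≤ N
  κ₃≤bound {k₃} {N} {S} (_ , least) ∣S∣≡3 bound = decidable-stable (k₃ ≤? N) λ k₃≰N →
    ¬¬-maximum (TreePacking G S) empty-packing bound λ (ℓ , p , max) →
    k₃≰N (≤-trans (least S ℓ ∣S∣≡3 (p , max)) (bound ℓ p))

  κ₃≤separator : ∀ {k₃ Q} → 3 ≤ n → IsKappa3 G k₃ → DisconnectsOrTrivial G Q → k₃ ≤ ∣ Q ∣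
  κ₃≤separator {k₃} {Q} _ ((S , ∣S∣≡3 , packed , _) , _) (inj₁ trivial) with enumerate S
  ... | e rewrite ∣S∣≡3 with e
  ...   | ter , inj , _ , into = ≤-pred (begin
            suc k₃                 ≤⟨ packing<n packed {ter 0F} {ter 1F} (λ eq → case inj eq of λ ()) (into 0F) (into 1F) ⟩
            n                      ≤⟨ m≤n+m∸n n ∣ Q ∣ ⟩
            ∣ Q ∣ + (n ∸ ∣ Q ∣)    ≤⟨ +-monoʳ-≤ ∣ Q ∣ (subst (_≤ 1) (∣∁p∣≡n∸∣p∣ Q) trivial) ⟩
            ∣ Q ∣ + 1              ≡⟨ +-comm ∣ Q ∣ 1 ⟩
            suc ∣ Q ∣              ∎)
    where open ≤-Reasoning
  κ₃≤separator {k₃} {Q} 3≤n kappa₃ (inj₂ (u , v , u∈ , v∈ , ¬walk)) =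
    separated (any? λ w → ¬? (w ≟ u) ×-dec ¬? (w ≟ v) ×-dec ¬? (w ∈? Q))
    where
    u≢v : u ≢ v
    u≢v refl = ¬walk (here u∈)
    corners : ∀ w → u ∈ triple u v w × v ∈ triple u v w
    corners w = ∈⟨⟩⁺ (inTriple? u v w) (inj₁ refl) , ∈⟨⟩⁺ (inTriple? u v w) (inj₂ (inj₁ refl))
    separated : Dec (∃ λ w → w ≢ u × w ≢ v × w ∉ Q) → k₃ ≤ ∣ Q ∣
    separated (yes (w , w≢u , w≢v , w∉Q)) = κ₃≤bound kappa₃ (∣triple∣ u v w u≢v w≢u w≢v) λ ℓ packed →
      packing≤cut packed u≢v (proj₁ (corners w)) (proj₂ (corners w)) Q outside ¬walk
      where
      outside : ∀ {x} → x ∈ triple u v w → x ∉ Q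
      outside x∈ with ∈⟨⟩⁻ (inTriple? u v w) x∈
      ... | inj₁ refl        = x∈∁p⇒x∉p u∈
      ... | inj₂ (inj₁ refl) = x∈∁p⇒x∉p v∈
      ... | inj₂ (inj₂ refl) = w∉Q
    -- Every vertex other than `u` and `v` lies in `Q`, so any third vertex may complete the triple.
    separated (no none) with third-vertex u v 3≤n
    ... | w , w≢u , w≢v = κ₃≤bound kappa₃ (∣triple∣ u v w u≢v w≢u w≢v) λ ℓ packed →
      packing≤dominating packed u≢v (proj₁ (corners w)) (proj₂ (corners w)) Q
        (λ e → ¬walk (step u∈ e (here v∈))) λ x x≢u x≢v → decidable-stable (x ∈? Q) λ x∉Q → none (x , x≢u , x≢v , x∉Q)

theorem4 : ∀ {n : ℕ} (G : Graph n) → 3 ≤ n → Connected G → Planar G →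
    ∀ (k k₃ : ℕ) → IsConnectivity G k → IsKappa3 G k₃ →
    (k ∸ 1 ≤ k₃) × (k₃ ≤ k)
theorem4 G 3≤n@(s≤s _) _ planar k k₃ ((Q , ∣Q∣≡k , separates) , κ) kappa₃@((S , ∣S∣≡3 , _ , max) , _) =
  decidable-stable (k ∸ 1 ≤? k₃) (λ ≰k₃ → manyTrees G (planar⇒connectivity≤5 G planar κ) κ ∣S∣≡3
    λ (ℓ , k∸1≤ℓ , packed) → ≰k₃ (≤-trans k∸1≤ℓ (max ℓ packed))) ,
  ≤-trans (κ₃≤separator G 3≤n kappa₃ separates) (≤-reflexive ∣Q∣≡k)
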